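{- Let $q>6.3\cdot 4^{13/3}$ be a prime power and let $f_1,f_2,f_3\in\mathbb{F}_q[X,Y,Z]$ be of degree $3$ with $f_i(0,0,0)=0$. Let $\mathcal{S}_{f_1,f_2,f_3}\subset\mathrm{PG}(6,q)$ be the hypersurface $F(X_0,\dots,X_6)=0$, where $F$ is the homogeneous polynomial whose dehomogenization is \[ F(1,X_1,\dots,X_6)=(X_1-X_4)\big(f_3(X_4,X_5,X_6)-f_3(X_1,X_2,X_3)\big)+(X_2-X_5)\big(f_2(X_4,X_5,X_6)-f_2(X_1,X_2,X_3)\big)+(X_3-X_6)\big(f_1(X_4,X_5,X_6)-f_1(X_1,X_2,X_3)\big). \] If $\mathcal{S}_{f_1,f_2,f_3}$ splits into four hyperplanes, then \[ \mathcal{O}_7(f_1,f_2,f_3)=\{(1,x,y,z,f_1(x,y,z),f_2(x,y,z),f_3(x,y,z),-zf_1(x,y,z)-yf_2(x,y,z)-xf_3(x,y,z)) : x,y,z\in\mathbb{F}_q\}\cup\{(0,0,0,0,0,0,0,1)\} \] is not an ovoid of the hyperbolic quadric $Q: X_0X_7+X_1X_6+X_2X_5+X_3X_4=0$ of $\mathrm{PG}(7,q)$.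
   Context: An ovoid of $Q$ is a set of points of $Q$ meeting every generator (maximal totally singular subspace) of $Q$ in exactly one point. "Splits into four hyperplanes" means $F$ factors over the algebraic closure of $\mathbb{F}_q$ as a product of four linear forms. -}

module Defs where

open import Level using (0ℓ)
open import Algebra.Bundles using (CommutativeRing)
open import Algebra.Morphism.Structures using (module RingMorphisms)
open import Data.Nat using (ℕ; zero; suc; _∸_; _^_; _≤_; _<_)
import Data.Nat as ℕ
open import Data.Nat.Primality using (Prime)
open import Data.Bool using (Bool; true; false; _∧_; if_then_else_)
open import Data.Fin using (Fin; zero; suc)
open import Data.Vec using (Vec; []; _∷_; lookup)
import Data.Vec as Vec
open import Data.List using (List; []; _∷_; [_]; concatMap; map; upTo; foldr)
open import Data.Product using (Σ; ∃; _×_; _,_)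
open import Data.Sum using (_⊎_; inj₁; inj₂)
open import Data.Unit using (⊤; tt)
open import Relation.Nullary using (¬_)
open import Relation.Binary.PropositionalEquality using (_≡_)

record Field : Set₁ where
  field
    commutativeRing : CommutativeRing 0ℓ 0ℓ
  open CommutativeRing commutativeRing public
  field
    1≉0     : ¬ (1# ≈ 0#)
    inverse : ∀ x → ¬ (x ≈ 0#) → ∃ λ y → (x * y) ≈ 1#

IsFieldHom : (K L : Field) → (Field.Carrier K → Field.Carrier L) → Set
IsFieldHom K L φ = RingMorphisms.IsRingHomomorphism (Field.rawRing K) (Field.rawRing L) φ

HasSize : Field → ℕ → Set
HasSize F q = Σ (Fin q → Carrier) λ e →
                 (∀ i j → e i ≈ e j → i ≡ j) × (∀ x → ∃ λ i → e i ≈ x)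
  where open Field F

IsPrimePower : ℕ → Set
IsPrimePower q = ∃ λ p → ∃ λ k → Prime p × (1 ≤ k) × (q ≡ p ^ k)

-- Multivariate polynomials in n variables with coefficients in A,
-- as formal expressions; polynomial identity is coefficientwise.

data Expr (A : Set) (n : ℕ) : Set where
  var : Fin n → Expr A n
  con : A → Expr A n
  _⊕_ : Expr A n → Expr A n → Expr A n
  _⊗_ : Expr A n → Expr A n → Expr A n
  ⊝_  : Expr A n → Expr A n

infixl 6 _⊕_ _⊖_
infixl 7 _⊗_

_⊖_ : ∀ {A n} → Expr A n → Expr A n → Expr A n
e ⊖ e' = e ⊕ (⊝ e')

sub : ∀ {A m n} → Expr A m → (Fin m → Expr A n) → Expr A n
sub (var i) s = s i
sub (con c) s = con c
sub (e ⊕ e') s = sub e s ⊕ sub e' s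
sub (e ⊗ e') s = sub e s ⊗ sub e' s
sub (⊝ e) s = ⊝ sub e s

-- Monomials: exponent vectors.  Total degree:
deg : ∀ {n} → Vec ℕ n → ℕ
deg = Vec.sum

allZero : ∀ {n} → Vec ℕ n → Bool
allZero [] = true
allZero (zero ∷ α) = allZero α
allZero (suc _ ∷ α) = false

isUnit : ∀ {n} → Fin n → Vec ℕ n → Bool
isUnit zero (1 ∷ α) = allZero α
isUnit zero (_ ∷ α) = false
isUnit (suc i) (zero ∷ α) = isUnit i α
isUnit (suc i) (suc _ ∷ α) = false

splits : ∀ {n} → Vec ℕ n → List (Vec ℕ n × Vec ℕ n)
splits [] = [ ([] , []) ]
splits (a ∷ α) =
  concatMap (λ i → map (λ { (β , γ) → (i ∷ β , (a ∸ i) ∷ γ) }) (splits α)) (upTo (suc a))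

module Poly (F : Field) where
  open Field F hiding (zero)

  sumL : List Carrier → Carrier
  sumL = foldr _+_ 0#

  coeff : ∀ {n} → Expr Carrier n → Vec ℕ n → Carrier
  coeff (var i) α = if isUnit i α then 1# else 0#
  coeff (con c) α = if allZero α then c else 0#
  coeff (e ⊕ e') α = coeff e α + coeff e' α
  coeff (e ⊗ e') α = sumL (map (λ { (β , γ) → coeff e β * coeff e' γ }) (splits α))
  coeff (⊝ e) α = - coeff e α

  eval : ∀ {n} → Expr Carrier n → (Fin n → Carrier) → Carrier
  eval (var i) x = x i
  eval (con c) x = c
  eval (e ⊕ e') x = eval e x + eval e' x
  eval (e ⊗ e') x = eval e x * eval e' x
  eval (⊝ e) x = - eval e x

  HasDegree : ∀ {n} → Expr Carrier n → ℕ → Set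
  HasDegree e d = (∀ α → d < deg α → coeff e α ≈ 0#)
                × (∃ λ α → (deg α ≡ d) × ¬ (coeff e α ≈ 0#))

  -- Coefficients of the homogenization (in the new variable X₀, placed
  -- first) of degree d of a polynomial e in n variables.
  homCoeff : ∀ {n} → Expr Carrier n → ℕ → Vec ℕ (suc n) → Carrier
  homCoeff e d (a₀ ∷ α) = if (a₀ ℕ.+ deg α) ℕ.≡ᵇ d then coeff e α else 0#

  ΣE : ∀ {m n} → (Fin m → Expr Carrier n) → Expr Carrier n
  ΣE {zero} f = con 0#
  ΣE {suc m} f = f zero ⊕ ΣE (λ i → f (suc i))

  linForm : ∀ {n} → (Fin n → Carrier) → Expr Carrier n
  linForm c = ΣE (λ i → con (c i) ⊗ var i)

  NonZeroVec : ∀ {n} → (Fin n → Carrier) → Set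
  NonZeroVec v = ∃ λ i → ¬ (v i ≈ 0#)

-- "The hypersurface F = 0, F the homogenization of G (of degree deg G),
-- splits into four hyperplanes": over some extension field K of 𝔽_q
-- (equivalently over the algebraic closure) F is a product of four
-- (nonzero) linear forms.

SplitsIntoFourHyperplanes : (Fq : Field) {n : ℕ} → Expr (Field.Carrier Fq) n → Set₁
SplitsIntoFourHyperplanes Fq {n} G =
  Σ ℕ λ d → HasDegree G d ×
  Σ Field λ K → Σ (Field.Carrier Fq → Field.Carrier K) λ φ → IsFieldHom Fq K φ ×
  Σ (Fin 4 → Fin (suc n) → Field.Carrier K) λ ℓ →
    (∀ j → Poly.NonZeroVec K (ℓ j)) ×
    (∀ β → Field._≈_ K (φ (homCoeff G d β))
                      (Poly.coeff K (Poly.linForm K (ℓ (# 0)) ⊗ Poly.linForm K (ℓ (# 1))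
                               ⊗ Poly.linForm K (ℓ (# 2)) ⊗ Poly.linForm K (ℓ (# 3))) β))
  where
    open Poly Fq
    open Data.Fin using (#_)

module Geometry (F : Field) where
  open Field F hiding (zero)
  open Data.Fin using (#_)

  Vec8 : Set
  Vec8 = Fin 8 → Carrier

  Q : Vec8 → Carrier
  Q v = v (# 0) * v (# 7) + v (# 1) * v (# 6) + v (# 2) * v (# 5) + v (# 3) * v (# 4)

  NonZero8 : Vec8 → Set
  NonZero8 v = ∃ λ i → ¬ (v i ≈ 0#)

  comb : (Fin 4 → Carrier) → (Fin 4 → Vec8) → Vec8
  comb λ′ b k = λ′ (# 0) * b (# 0) k + λ′ (# 1) * b (# 1) k
              + λ′ (# 2) * b (# 2) k + λ′ (# 3) * b (# 3) k

  LinIndep : (Fin 4 → Vec8) → Set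
  LinIndep b = ∀ λ′ → (∀ k → comb λ′ b k ≈ 0#) → ∀ i → λ′ i ≈ 0#

  -- b spans a generator of Q: a totally singular subspace of vector
  -- dimension 4 (projective dimension 3, the maximum for Q⁺(7,q)).
  IsGeneratorBasis : (Fin 4 → Vec8) → Set
  IsGeneratorBasis b = LinIndep b × (∀ λ′ → Q (comb λ′ b) ≈ 0#)

  InSpan : Vec8 → (Fin 4 → Vec8) → Set
  InSpan v b = ∃ λ λ′ → ∀ k → v k ≈ comb λ′ b k

  SamePoint : Vec8 → Vec8 → Set
  SamePoint u v = ∃ λ c → ∀ k → u k ≈ c * v k

  -- A set of points of PG(7,q), given as the image of a family P of
  -- (nonzero) coordinate vectors, is an ovoid of Q: all its points lie on
  -- Q, and every generator of Q contains exactly one of its points.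
  IsOvoid : {I : Set} → (I → Vec8) → Set
  IsOvoid {I} P =
    (∀ i → NonZero8 (P i) × Q (P i) ≈ 0#) ×
    (∀ b → IsGeneratorBasis b →
       (∃ λ i → InSpan (P i) b) ×
       (∀ i j → InSpan (P i) b → InSpan (P j) b → SamePoint (P i) (P j)))

module Construction (Fq : Field) where
  open Field Fq hiding (zero)
  open Poly Fq
  open Data.Fin using (#_)

  -- variables X₁ … X₆ of the affine chart X₀ = 1 (indices 0 … 5)
  X : Fin 6 → Expr Carrier 6
  X = var

  at : Expr Carrier 3 → Expr Carrier 6 → Expr Carrier 6 → Expr Carrier 6 → Expr Carrier 6
  at f a b c = sub f (lookup (a ∷ b ∷ c ∷ []))

  Gpoly : (f₁ f₂ f₃ : Expr Carrier 3) → Expr Carrier 6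
  Gpoly f₁ f₂ f₃ =
      (X (# 0) ⊖ X (# 3)) ⊗ (at f₃ (X (# 3)) (X (# 4)) (X (# 5)) ⊖ at f₃ (X (# 0)) (X (# 1)) (X (# 2)))
    ⊕ (X (# 1) ⊖ X (# 4)) ⊗ (at f₂ (X (# 3)) (X (# 4)) (X (# 5)) ⊖ at f₂ (X (# 0)) (X (# 1)) (X (# 2)))
    ⊕ (X (# 2) ⊖ X (# 5)) ⊗ (at f₁ (X (# 3)) (X (# 4)) (X (# 5)) ⊖ at f₁ (X (# 0)) (X (# 1)) (X (# 2)))

  O₇ : (f₁ f₂ f₃ : Expr Carrier 3) → (Carrier × Carrier × Carrier) ⊎ ⊤ → Fin 8 → Carrier
  O₇ f₁ f₂ f₃ (inj₁ (x , y , z)) =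
    lookup (1# ∷ x ∷ y ∷ z ∷ v₁ ∷ v₂ ∷ v₃ ∷ (- (z * v₁) - y * v₂ - x * v₃) ∷ [])
    where
      pt = lookup (x ∷ y ∷ z ∷ [])
      v₁ = eval f₁ pt
      v₂ = eval f₂ pt
      v₃ = eval f₃ pt
  O₇ f₁ f₂ f₃ (inj₂ tt) = lookup (0# ∷ 0# ∷ 0# ∷ 0# ∷ 0# ∷ 0# ∷ 0# ∷ 1# ∷ [])

{-# OPTIONS --safe #-}

-- Write G(a, b) = (a − b)·(g(b) − g(a)) with g = (f₃, f₂, f₁); up to sign it is the polar form of
-- the points of 𝒪₇ with parameters a and b.  Since g(0) = 0, a nonzero u ∈ 𝔽_q³ with G(u, 0) = 0
-- gives a generator through two points of 𝒪₇, so we may assume that there is no such u.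
--
-- G vanishes on the diagonal a = b, hence so does one of its four linear factors, which therefore
-- is c·(a − b), where no nonzero u ∈ 𝔽_q³ satisfies c·u = 0.  Let σ be the q-power Frobenius map
-- of the extension field.  G has coefficients in 𝔽_q, so it vanishes on the hyperplanes
-- c·(a − b) = 0, σ(c)·(a − b) = 0 and σ²(c)·(a − b) = 0.  The Moore determinant of c is nonzero,
-- so these are three linearly independent factors L₁, L₂, L₃ of G.  Let D be the fourth factor.
-- Every term of G has degree at most 1 in a or degree at most 1 in b.  Choosing a, b with
-- L₂(a) = L₃(a) = L₁(b) = 0, the terms of bidegree (2, 2) of L₁L₂L₃D show that the linear part
-- of D vanishes at a; by symmetry D is constant, but the homogenization of G is not divisible by X₀.
--
-- The extension field need not have decidable equality, but since a negation is proved its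
-- equality may be replaced by its double negation.

module Submission where

open import Defs
open import Level using (0ℓ)
open import Algebra.Bundles using (CommutativeRing)
import Algebra.Morphism.Construct.Composition as Composition
import Algebra.Morphism.Construct.Identity as Identity
open import Algebra.Morphism.Structures using (module RingMorphisms)
import Algebra.Properties.AbelianGroup
import Algebra.Properties.CommutativeMonoid.Sum
import Algebra.Properties.CommutativeSemigroup
import Algebra.Properties.CommutativeSemiring.Binomial
import Algebra.Properties.CommutativeSemiring.Exp
import Algebra.Properties.Group
import Algebra.Properties.Ring
import Algebra.Properties.Semiring.Exp
import Algebra.Properties.Semiring.Mult
import Algebra.Properties.Semiring.Mult.TCOptimised
import Algebra.Solver.Ring
open import Algebra.Solver.Ring.AlmostCommutativeRing using (fromCommutativeRing; _-Raw-AlmostCommutative⟶_)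
open import Data.Bool as Bool using (true; false; if_then_else_)
open import Data.Empty using (⊥)
open import Data.Fin as Fin using (Fin; zero; suc; toℕ; inject₁; inject≤; punchIn)
open import Data.Fin.Patterns
open import Data.Fin.Permutation using (Permutation; permutation; _⟨$⟩ʳ_)
import Data.Fin.Properties as Fin
open import Data.Integer as ℤ using (ℤ; +_; -[1+_])
import Data.Integer.Properties as ℤ
open import Data.List as List using (List; []; _∷_; [_]; _++_; map; concatMap; upTo; applyUpTo)
import Data.List.Properties as List
open import Data.Maybe using (Maybe; just; nothing)
open import Data.Nat as ℕ using (ℕ; zero; suc; _∸_; _≤_; _<_; z≤n; s≤s; NonZero; _!)
open import Data.Nat.Combinatorics as ℕ using (nCn≡1; nCk≡n!/k![n-k]!; k![n∸k]!∣n!)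
open import Data.Nat.Divisibility using (_∣_; divides; m∣m*n; >⇒∤)
open import Data.Nat.DivMod using (m/n*n≡m)
open import Data.Nat.Primality using (Prime; euclidsLemma; prime⇒nonTrivial)
import Data.Nat.Properties as ℕ
open import Data.Product using (∃; _×_; _,_; proj₁; proj₂)
open import Data.Sum using (_⊎_; inj₁; inj₂)
open import Data.Unit using (tt)
open import Data.Vec using (Vec; []; _∷_; lookup; replicate; zipWith)
open import Function using (_∘_; id)
open import Relation.Binary.PropositionalEquality as ≡ using (_≡_; _≢_)
import Relation.Binary.Reasoning.Setoid
open import Relation.Nullary using (¬_; Dec; yes; no; contradiction)
import Relation.Nullary.Decidable as Dec

-- The splitting is an identity of coefficients, whereas vanishing on a subspace concerns values.
-- Both views are needed: σ has to act on the coefficients of the factors, since acting on values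
-- would move the point as well. So the splitting is conjugated before it is evaluated at `X₀ = 1`.
--
-- On values, unique factorization gives way to counting. Along a line an affine function is zero
-- everywhere or at most once, so four functions, none of them zero on the whole subspace, are made
-- nonzero together with at most five parameters per line; the parameters are elements of 𝔽_q. The
-- bidegree argument is also put in terms of values: a second difference in two scalars s and t
-- kills `G` and turns the product of the factors into a multiple of (s² - s)(t² - t).
--
-- Pairs (u, 0) are enough on the side of the ovoid: they give c·u ≠ 0 for nonzero u, that is, the
-- independence over 𝔽_q of the coordinates of c, which is what the Moore determinant asks for.

-- Ring solver with integer coefficients

module IntegerSolver (R : CommutativeRing 0ℓ 0ℓ) where
  open CommutativeRing R
  open Algebra.Properties.Ring ring using (-0#≈0#; -‿distribˡ-*; -‿distribʳ-*; -‿involutive)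
  open Algebra.Properties.AbelianGroup +-abelianGroup using (⁻¹-∙-comm)
  open Algebra.Properties.Semiring.Mult.TCOptimised semiring renaming (_×_ to _·_)
  open Relation.Binary.Reasoning.Setoid setoid

  -- The optimised multiple makes `0 · 1#` and `1 · 1#` compute to `0#` and `1#`, so `con (+ 0)` and
  -- `con (+ 1)` in solver goals are the ring constants definitionally.
  fromℤ : ℤ → Carrier
  fromℤ (+ n) = n · 1#
  fromℤ -[1+ n ] = - (suc n · 1#)

  fromℤ-neg : ∀ i → fromℤ (ℤ.- i) ≈ - fromℤ i
  fromℤ-neg (+ zero) = sym -0#≈0#
  fromℤ-neg (+ suc n) = refl
  fromℤ-neg -[1+ n ] = sym (-‿involutive _)

  fromℤ-⊖ : ∀ m n → fromℤ (m ℤ.⊖ n) ≈ m · 1# - n · 1#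
  fromℤ-⊖ m zero = begin
    m · 1#          ≈⟨ +-identityʳ _ ⟨
    m · 1# + 0#     ≈⟨ +-congˡ -0#≈0# ⟨
    m · 1# - 0#     ∎
  fromℤ-⊖ zero (suc n) = sym (+-identityˡ _)
  fromℤ-⊖ (suc m) (suc n) = begin
    fromℤ (suc m ℤ.⊖ suc n)               ≡⟨ ≡.cong fromℤ (ℤ.[1+m]⊖[1+n]≡m⊖n m n) ⟩
    fromℤ (m ℤ.⊖ n)                       ≈⟨ fromℤ-⊖ m n ⟩
    m · 1# - n · 1#                     ≈⟨ +-congʳ (+-identityʳ _) ⟨
    m · 1# + 0# - n · 1#                ≈⟨ +-congʳ (+-congˡ (-‿inverseʳ 1#)) ⟨
    m · 1# + (1# - 1#) - n · 1#         ≈⟨ +-congʳ (+-assoc _ _ _) ⟨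
    m · 1# + 1# - 1# - n · 1#           ≈⟨ +-assoc _ _ _ ⟩
    m · 1# + 1# + (- 1# - n · 1#)       ≈⟨ +-cong (+-comm _ _) (⁻¹-∙-comm _ _) ⟩
    1# + m · 1# - (1# + n · 1#)         ≈⟨ +-cong (1+× m 1#) (-‿cong (1+× n 1#)) ⟨
    suc m · 1# - suc n · 1#             ∎

  fromℤ-+ : ∀ i j → fromℤ (i ℤ.+ j) ≈ fromℤ i + fromℤ j
  fromℤ-+ (+ m) (+ n) = ×-homo-+ 1# m n
  fromℤ-+ (+ m) -[1+ n ] = fromℤ-⊖ m (suc n)
  fromℤ-+ -[1+ m ] (+ n) = trans (fromℤ-⊖ n (suc m)) (+-comm _ _)
  fromℤ-+ -[1+ m ] -[1+ n ] = begin
    - (suc (suc (m ℕ.+ n)) · 1#)        ≡⟨ ≡.cong (λ k → - (k · 1#)) (≡.cong suc (ℕ.+-suc m n)) ⟨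
    - ((suc m ℕ.+ suc n) · 1#)          ≈⟨ -‿cong (×-homo-+ 1# (suc m) (suc n)) ⟩
    - (suc m · 1# + suc n · 1#)         ≈⟨ ⁻¹-∙-comm _ _ ⟨
    - (suc m · 1#) - suc n · 1#         ∎

  fromℤ-* : ∀ i j → fromℤ (i ℤ.* j) ≈ fromℤ i * fromℤ j
  fromℤ-* (+ m) (+ n) = begin
    fromℤ (+ m ℤ.* + n)                 ≡⟨ ≡.cong fromℤ (ℤ.pos-* m n) ⟨
    (m ℕ.* n) · 1#                      ≈⟨ ×1-homo-* m n ⟩
    m · 1# * n · 1#                     ∎
  fromℤ-* (+ m) -[1+ n ] = begin
    fromℤ (+ m ℤ.* -[1+ n ])            ≡⟨ ≡.cong fromℤ (ℤ.neg-distribʳ-* (+ m) (+ suc n)) ⟨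
    fromℤ (ℤ.- (+ m ℤ.* + suc n))       ≈⟨ fromℤ-neg (+ m ℤ.* + suc n) ⟩
    - fromℤ (+ m ℤ.* + suc n)           ≈⟨ -‿cong (fromℤ-* (+ m) (+ suc n)) ⟩
    - (m · 1# * suc n · 1#)             ≈⟨ -‿distribʳ-* _ _ ⟩
    m · 1# * - (suc n · 1#)             ∎
  fromℤ-* -[1+ m ] (+ n) = begin
    fromℤ (-[1+ m ] ℤ.* + n)            ≡⟨ ≡.cong fromℤ (ℤ.neg-distribˡ-* (+ suc m) (+ n)) ⟨
    fromℤ (ℤ.- (+ suc m ℤ.* + n))       ≈⟨ fromℤ-neg (+ suc m ℤ.* + n) ⟩
    - fromℤ (+ suc m ℤ.* + n)           ≈⟨ -‿cong (fromℤ-* (+ suc m) (+ n)) ⟩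
    - (suc m · 1# * n · 1#)             ≈⟨ -‿distribˡ-* _ _ ⟩
    - (suc m · 1#) * n · 1#             ∎
  fromℤ-* -[1+ m ] -[1+ n ] = begin
    (suc m ℕ.* suc n) · 1#              ≈⟨ ×1-homo-* (suc m) (suc n) ⟩
    suc m · 1# * suc n · 1#             ≈⟨ -‿involutive _ ⟨
    - - (suc m · 1# * suc n · 1#)       ≈⟨ -‿cong (-‿distribˡ-* _ _) ⟩
    - (- (suc m · 1#) * suc n · 1#)     ≈⟨ -‿distribʳ-* _ _ ⟩
    - (suc m · 1#) * - (suc n · 1#)     ∎

  fromℤ-homomorphism : ℤ.+-*-rawRing -Raw-AlmostCommutative⟶ fromCommutativeRing R
  fromℤ-homomorphism = record
    { ⟦_⟧ = fromℤ ; +-homo = fromℤ-+ ; *-homo = fromℤ-* ; -‿homo = fromℤ-neg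
    ; 0-homo = refl ; 1-homo = refl }

  -- Coefficients are compared as integers because equality in `R` is not assumed decidable; the
  -- solver accepts such a one-sided test.
  fromℤ-≟ : ∀ i j → Maybe (fromℤ i ≈ fromℤ j)
  fromℤ-≟ i j with i ℤ.≟ j
  ... | yes ≡.refl = just refl
  ... | no _ = nothing

  open Algebra.Solver.Ring ℤ.+-*-rawRing (fromCommutativeRing R) fromℤ-homomorphism fromℤ-≟ public
    using (Polynomial; solve; _:=_; _:+_; _:*_; :-_; _:-_; con)

-- Coefficient functions of polynomials and their values

mapExpr : ∀ {A B n} → (A → B) → Expr A n → Expr B n
mapExpr φ (var i) = var i
mapExpr φ (con c) = con (φ c)
mapExpr φ (e ⊕ e') = mapExpr φ e ⊕ mapExpr φ e'
mapExpr φ (e ⊗ e') = mapExpr φ e ⊗ mapExpr φ e'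
mapExpr φ (⊝ e) = ⊝ mapExpr φ e

unit : ∀ {n} → Fin n → Vec ℕ n
unit zero = 1 ∷ replicate _ 0
unit (suc i) = 0 ∷ unit i

_⊞_ : ∀ {n} → Vec ℕ n → Vec ℕ n → Vec ℕ n
_⊞_ = zipWith ℕ._+_

allZero-replicate : ∀ n → allZero (replicate n 0) ≡ true
allZero-replicate zero = ≡.refl
allZero-replicate (suc n) = allZero-replicate n

allZero-false : ∀ {n} (α : Vec ℕ n) → α ≢ replicate n 0 → allZero α ≡ false
allZero-false [] α≢ = contradiction ≡.refl α≢
allZero-false (zero ∷ α) α≢ = allZero-false α (α≢ ∘ ≡.cong (0 ∷_))
allZero-false (suc _ ∷ α) α≢ = ≡.refl

isUnit-unit : ∀ {n} (i : Fin n) → isUnit i (unit i) ≡ true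
isUnit-unit {suc n} zero = allZero-replicate n
isUnit-unit (suc i) = isUnit-unit i

isUnit-false : ∀ {n} (i : Fin n) α → α ≢ unit i → isUnit i α ≡ false
isUnit-false zero (0 ∷ α) α≢ = ≡.refl
isUnit-false zero (1 ∷ α) α≢ = allZero-false α (α≢ ∘ ≡.cong (1 ∷_))
isUnit-false zero (suc (suc _) ∷ α) α≢ = ≡.refl
isUnit-false (suc i) (zero ∷ α) α≢ = isUnit-false i α (α≢ ∘ ≡.cong (0 ∷_))
isUnit-false (suc i) (suc _ ∷ α) α≢ = ≡.refl

-- Coefficient functions carry no support, so sums over all monomials are cut off at exponents below
-- `N`.
box : ℕ → (n : ℕ) → List (Vec ℕ n)
box N zero = [ [] ]
box N (suc n) = concatMap (λ i → map (i ∷_) (box N n)) (upTo N)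

module Coefficients (K : Field) where
  open Field K hiding (zero)
  open Poly K
  open Algebra.Properties.Ring ring using (-0#≈0#; -‿distribˡ-*)
  open Algebra.Properties.AbelianGroup +-abelianGroup using (⁻¹-∙-comm)
  open Algebra.Properties.Semiring.Exp semiring using (_^_; ^-homo-*)
  open Algebra.Properties.CommutativeSemigroup +-commutativeSemigroup using () renaming (interchange to +-interchange)
  open Algebra.Properties.CommutativeSemigroup *-commutativeSemigroup using () renaming (interchange to *-interchange)
  open Relation.Binary.Reasoning.Setoid setoid

  ∑ : {A : Set} → List A → (A → Carrier) → Carrier
  ∑ l f = sumL (map f l)

  ∑-cong : {A : Set} (l : List A) {f g : A → Carrier} → (∀ a → f a ≈ g a) → ∑ l f ≈ ∑ l g
  ∑-cong [] f≈g = refl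
  ∑-cong (a ∷ l) f≈g = +-cong (f≈g a) (∑-cong l f≈g)

  ∑-zero : {A : Set} (l : List A) {f : A → Carrier} → (∀ a → f a ≈ 0#) → ∑ l f ≈ 0#
  ∑-zero [] f≈0 = refl
  ∑-zero (a ∷ l) f≈0 = trans (+-cong (f≈0 a) (∑-zero l f≈0)) (+-identityˡ 0#)

  ∑-+ : {A : Set} (l : List A) {f g : A → Carrier} → ∑ l (λ a → f a + g a) ≈ ∑ l f + ∑ l g
  ∑-+ [] = sym (+-identityˡ 0#)
  ∑-+ (a ∷ l) = trans (+-congˡ (∑-+ l)) (+-interchange _ _ _ _)

  ∑-comm : {A B : Set} (l : List A) (m : List B) {f : A → B → Carrier} →
           ∑ l (λ a → ∑ m (f a)) ≈ ∑ m (λ b → ∑ l (λ a → f a b))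
  ∑-comm [] m = sym (∑-zero m (λ _ → refl))
  ∑-comm (a ∷ l) m = trans (+-congˡ (∑-comm l m)) (sym (∑-+ m))

  ∑-++ : {A : Set} (l m : List A) {f : A → Carrier} → ∑ (l ++ m) f ≈ ∑ l f + ∑ m f
  ∑-++ [] m = sym (+-identityˡ _)
  ∑-++ (a ∷ l) m = trans (+-congˡ (∑-++ l m)) (sym (+-assoc _ _ _))

  ∑-map : {A B : Set} (h : A → B) (l : List A) {f : B → Carrier} → ∑ (map h l) f ≈ ∑ l (f ∘ h)
  ∑-map h [] = refl
  ∑-map h (a ∷ l) = +-congˡ (∑-map h l)

  ∑-concatMap : {A B : Set} (k : A → List B) (l : List A) {f : B → Carrier} →
                ∑ (concatMap k l) f ≈ ∑ l (λ a → ∑ (k a) f)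
  ∑-concatMap k [] = refl
  ∑-concatMap k (a ∷ l) = trans (∑-++ (k a) (concatMap k l)) (+-congˡ (∑-concatMap k l))

  ∑-upTo-suc : ∀ n {f : ℕ → Carrier} → ∑ (upTo (suc n)) f ≈ f 0 + ∑ (upTo n) (f ∘ suc)
  ∑-upTo-suc n {f} = +-congˡ (begin
    ∑ (applyUpTo suc n) f        ≡⟨ ≡.cong (λ l → ∑ l f) (List.map-upTo suc n) ⟨
    ∑ (map suc (upTo n)) f       ≈⟨ ∑-map suc (upTo n) ⟩
    ∑ (upTo n) (f ∘ suc)         ∎)

  ∑-upTo-zero : ∀ n {f : ℕ → Carrier} → (∀ i → i < n → f i ≈ 0#) → ∑ (upTo n) f ≈ 0#
  ∑-upTo-zero zero f≈0 = refl
  ∑-upTo-zero (suc n) {f} f≈0 = begin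
    ∑ (upTo (suc n)) f            ≈⟨ ∑-upTo-suc n ⟩
    f 0 + ∑ (upTo n) (f ∘ suc)    ≈⟨ +-cong (f≈0 0 (s≤s z≤n)) (∑-upTo-zero n λ i i<n → f≈0 (suc i) (s≤s i<n)) ⟩
    0# + 0#                       ≈⟨ +-identityˡ 0# ⟩
    0#                            ∎

  ∑-upTo-single : ∀ n b {f : ℕ → Carrier} → b < n → (∀ i → i ≢ b → f i ≈ 0#) → ∑ (upTo n) f ≈ f b
  ∑-upTo-single (suc n) zero {f} _ f≈0 = begin
    ∑ (upTo (suc n)) f            ≈⟨ ∑-upTo-suc n ⟩
    f 0 + ∑ (upTo n) (f ∘ suc)    ≈⟨ +-congˡ (∑-zero (upTo n) (λ i → f≈0 (suc i) λ ())) ⟩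
    f 0 + 0#                      ≈⟨ +-identityʳ _ ⟩
    f 0                           ∎
  ∑-upTo-single (suc n) (suc b) {f} (s≤s b<n) f≈0 = begin
    ∑ (upTo (suc n)) f            ≈⟨ ∑-upTo-suc n ⟩
    f 0 + ∑ (upTo n) (f ∘ suc)    ≈⟨ +-cong (f≈0 0 λ ()) (∑-upTo-single n b b<n λ i i≢b → f≈0 (suc i) (i≢b ∘ ℕ.suc-injective)) ⟩
    0# + f (suc b)                ≈⟨ +-identityˡ _ ⟩
    f (suc b)                     ∎

  conv : ∀ {n} → (Vec ℕ n → Carrier) → (Vec ℕ n → Carrier) → Vec ℕ n → Carrier
  conv F G α = ∑ (splits α) (λ p → F (proj₁ p) * G (proj₂ p))

  coeff-⊗ : ∀ {n} (e e' : Expr Carrier n) α → coeff (e ⊗ e') α ≈ conv (coeff e) (coeff e') α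
  coeff-⊗ e e' α = ∑-cong (splits α) λ _ → refl

  conv-cong : ∀ {n} {F F' G G' : Vec ℕ n → Carrier} → (∀ α → F α ≈ F' α) → (∀ α → G α ≈ G' α) →
              ∀ α → conv F G α ≈ conv F' G' α
  conv-cong F≈ G≈ α = ∑-cong (splits α) λ p → *-cong (F≈ _) (G≈ _)

  conv-zeroˡ : ∀ {n} {F G : Vec ℕ n → Carrier} → (∀ α → F α ≈ 0#) → ∀ α → conv F G α ≈ 0#
  conv-zeroˡ F≈0 α = ∑-zero (splits α) λ p → trans (*-congʳ (F≈0 _)) (zeroˡ _)

  conv-zeroʳ : ∀ {n} {F G : Vec ℕ n → Carrier} → (∀ α → G α ≈ 0#) → ∀ α → conv F G α ≈ 0#
  conv-zeroʳ G≈0 α = ∑-zero (splits α) λ p → trans (*-congˡ (G≈0 _)) (zeroʳ _)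

  conv-+ˡ : ∀ {n} (F F' G : Vec ℕ n → Carrier) α →
            conv (λ β → F β + F' β) G α ≈ conv F G α + conv F' G α
  conv-+ˡ F F' G α = trans (∑-cong (splits α) λ _ → distribʳ _ _ _) (∑-+ (splits α))

  conv-+ʳ : ∀ {n} (F G G' : Vec ℕ n → Carrier) α →
            conv F (λ β → G β + G' β) α ≈ conv F G α + conv F G' α
  conv-+ʳ F G G' α = trans (∑-cong (splits α) λ _ → distribˡ _ _ _) (∑-+ (splits α))

  conv-∷ : ∀ {n} (F G : Vec ℕ (suc n) → Carrier) a α →
           conv F G (a ∷ α) ≈ ∑ (upTo (suc a)) (λ i → conv (F ∘ (i ∷_)) (G ∘ ((a ∸ i) ∷_)) α)
  conv-∷ F G a α = trans
    (∑-concatMap (λ i → map (cons i) (splits α)) (upTo (suc a)) {f})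
    (∑-cong (upTo (suc a)) λ i → ∑-map (cons i) (splits α) {f})
    where
    f = λ p → F (proj₁ p) * G (proj₂ p)
    cons = λ i p → (i ∷ proj₁ p , (a ∸ i) ∷ proj₂ p)

  -- Among all splittings of an exponent vector only `(β , γ)` meets both supports. In the induction
  -- the first exponent must split as `b` and `c`, which leaves a single term of the outer sum.
  conv-supp : ∀ {n} (F G : Vec ℕ n → Carrier) β γ →
              (∀ α → α ≢ β → F α ≈ 0#) → (∀ α → α ≢ γ → G α ≈ 0#) →
              (∀ α → α ≢ β ⊞ γ → conv F G α ≈ 0#) × conv F G (β ⊞ γ) ≈ F β * G γ
  conv-supp F G [] [] _ _ = (λ { [] []≢ → contradiction ≡.refl []≢ }) , +-identityʳ _
  conv-supp F G (b ∷ β) (c ∷ γ) F0 G0 = off , on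
    where
    term : ℕ → Vec ℕ _ → ℕ → Carrier
    term a α i = conv (F ∘ (i ∷_)) (G ∘ ((a ∸ i) ∷_)) α

    term-off : ∀ a α i → i ≢ b → term a α i ≈ 0#
    term-off a α i i≢b = conv-zeroˡ (λ β' → F0 (i ∷ β') λ { ≡.refl → i≢b ≡.refl }) α

    rec = conv-supp (F ∘ (b ∷_)) (G ∘ (c ∷_)) β γ
      (λ α α≢ → F0 (b ∷ α) λ { ≡.refl → α≢ ≡.refl }) (λ α α≢ → G0 (c ∷ α) λ { ≡.refl → α≢ ≡.refl })

    off : ∀ α → α ≢ (b ∷ β) ⊞ (c ∷ γ) → conv F G α ≈ 0#
    off (a ∷ α) α≢ = trans (conv-∷ F G a α) (∑-upTo-zero (suc a) each)
      where
      each : ∀ i → i < suc a → term a α i ≈ 0#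
      each i (s≤s i≤a) with i ℕ.≟ b | a ∸ b ℕ.≟ c
      ... | no i≢b | _ = term-off a α i i≢b
      ... | yes ≡.refl | no a∸b≢c = conv-zeroʳ (λ γ' → G0 (a ∸ b ∷ γ') λ { ≡.refl → a∸b≢c ≡.refl }) α
      ... | yes ≡.refl | yes a∸b≡c = trans
        (reflexive (≡.cong (λ k → conv (F ∘ (b ∷_)) (G ∘ (k ∷_)) α) a∸b≡c))
        (proj₁ rec α λ { ≡.refl → α≢ (≡.cong (_∷ _)
          (≡.trans (≡.sym (ℕ.m+[n∸m]≡n i≤a)) (≡.cong (b ℕ.+_) a∸b≡c))) })

    on : conv F G ((b ∷ β) ⊞ (c ∷ γ)) ≈ F (b ∷ β) * G (c ∷ γ)
    on = begin
      conv F G (b ℕ.+ c ∷ β ⊞ γ)   ≈⟨ conv-∷ F G (b ℕ.+ c) (β ⊞ γ) ⟩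
      ∑ (upTo (suc (b ℕ.+ c))) (term (b ℕ.+ c) (β ⊞ γ))                            ≈⟨ ∑-upTo-single (suc (b ℕ.+ c)) b (s≤s (ℕ.m≤m+n b c)) (term-off (b ℕ.+ c) (β ⊞ γ)) ⟩
      term (b ℕ.+ c) (β ⊞ γ) b     ≡⟨ ≡.cong (λ k → conv (F ∘ (b ∷_)) (G ∘ (k ∷_)) (β ⊞ γ)) (ℕ.m+n∸m≡n b c) ⟩
      _                            ≈⟨ proj₂ rec ⟩
      F (b ∷ β) * G (c ∷ γ)        ∎

  monomial : ∀ {n} → (Fin n → Carrier) → Vec ℕ n → Carrier
  monomial x [] = 1#
  monomial x (b ∷ β) = x zero ^ b * monomial (x ∘ suc) β

  monomial-⊞ : ∀ {n} (x : Fin n → Carrier) β γ → monomial x (β ⊞ γ) ≈ monomial x β * monomial x γ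
  monomial-⊞ x [] [] = sym (*-identityˡ 1#)
  monomial-⊞ x (b ∷ β) (c ∷ γ) =
    trans (*-cong (^-homo-* (x zero) b c) (monomial-⊞ (x ∘ suc) β γ)) (*-interchange _ _ _ _)

  monomial-0 : ∀ {n} (x : Fin n → Carrier) → monomial x (replicate n 0) ≈ 1#
  monomial-0 {zero} x = refl
  monomial-0 {suc n} x = trans (*-identityˡ _) (monomial-0 (x ∘ suc))

  monomial-unit : ∀ {n} (x : Fin n → Carrier) i → monomial x (unit i) ≈ x i
  monomial-unit x zero = trans (*-cong (*-identityʳ _) (monomial-0 (x ∘ suc))) (*-identityʳ _)
  monomial-unit x (suc i) = trans (*-identityˡ _) (monomial-unit (x ∘ suc) i)

  -- F is the coefficient function of a polynomial whose value at x is v.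
  data Represents {n : ℕ} (x : Fin n → Carrier) : (Vec ℕ n → Carrier) → Carrier → Set where
    mono : ∀ {F v} β → (∀ α → α ≢ β → F α ≈ 0#) → v ≈ F β * monomial x β → Represents x F v
    add  : ∀ {F G H u v w} → Represents x F u → Represents x G v →
           (∀ α → H α ≈ F α + G α) → w ≈ u + v → Represents x H w

  module _ {n : ℕ} {x : Fin n → Carrier} where
    represents-cong : ∀ {F G u v} → (∀ α → G α ≈ F α) → v ≈ u → Represents x F u → Represents x G v
    represents-cong G≈F v≈u (mono β F0 u≈) =
      mono β (λ α α≢ → trans (G≈F α) (F0 α α≢)) (trans v≈u (trans u≈ (*-congʳ (sym (G≈F β)))))
    represents-cong G≈F v≈u (add r s F≈ u≈) = add r s (λ α → trans (G≈F α) (F≈ α)) (trans v≈u u≈)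

    represents-neg : ∀ {F v} → Represents x F v → Represents x (λ α → - F α) (- v)
    represents-neg (mono β F0 v≈) =
      mono β (λ α α≢ → trans (-‿cong (F0 α α≢)) -0#≈0#) (trans (-‿cong v≈) (-‿distribˡ-* _ _))
    represents-neg (add r s F≈ v≈) = add (represents-neg r) (represents-neg s)
      (λ α → trans (-‿cong (F≈ α)) (sym (⁻¹-∙-comm _ _))) (trans (-‿cong v≈) (sym (⁻¹-∙-comm _ _)))

    represents-conv : ∀ {F G u v} → Represents x F u → Represents x G v → Represents x (conv F G) (u * v)
    represents-conv {F} {G} {u} {v} (mono β F0 u≈) (mono γ G0 v≈) with conv-supp F G β γ F0 G0
    ... | off , on = mono (β ⊞ γ) off (begin
      u * v                                                ≈⟨ *-cong u≈ v≈ ⟩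
      (F β * monomial x β) * (G γ * monomial x γ)          ≈⟨ *-interchange _ _ _ _ ⟩
      (F β * G γ) * (monomial x β * monomial x γ)          ≈⟨ *-cong on (monomial-⊞ x β γ) ⟨
      conv F G (β ⊞ γ) * monomial x (β ⊞ γ)                ∎)
    represents-conv {F} r@(mono _ _ _) (add {G} {G'} s s' G≈ v≈) =
      add (represents-conv r s) (represents-conv r s')
        (λ α → trans (conv-cong (λ _ → refl) G≈ α) (conv-+ʳ F G G' α)) (trans (*-congˡ v≈) (distribˡ _ _ _))
    represents-conv {G = G} (add {F} {F'} r r' F≈ u≈) s =
      add (represents-conv r s) (represents-conv r' s)
        (λ α → trans (conv-cong F≈ (λ _ → refl) α) (conv-+ˡ F F' G α)) (trans (*-congʳ u≈) (distribʳ _ _ _))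

    represents-eval : (e : Expr Carrier n) → Represents x (coeff e) (eval e x)
    represents-eval (var i) = mono (unit i)
      (λ α α≢ → reflexive (≡.cong (if_then 1# else 0#) (isUnit-false i α α≢)))
      (sym (trans (*-cong (reflexive (≡.cong (if_then 1# else 0#) (isUnit-unit i))) (monomial-unit x i)) (*-identityˡ _)))
    represents-eval (con c) = mono (replicate n 0)
      (λ α α≢ → reflexive (≡.cong (if_then c else 0#) (allZero-false α α≢)))
      (sym (trans (*-cong (reflexive (≡.cong (if_then c else 0#) (allZero-replicate n))) (monomial-0 x)) (*-identityʳ _)))
    represents-eval (e ⊕ e') = add (represents-eval e) (represents-eval e') (λ _ → refl) refl
    represents-eval (e ⊗ e') =
      represents-cong (coeff-⊗ e e') refl (represents-conv (represents-eval e) (represents-eval e'))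
    represents-eval (⊝ e) = represents-neg (represents-eval e)

  ∑-box-suc : ∀ N n {f : Vec ℕ (suc n) → Carrier} →
              ∑ (box N (suc n)) f ≈ ∑ (upTo N) (λ i → ∑ (box N n) (λ α → f (i ∷ α)))
  ∑-box-suc N n {f} = trans (∑-concatMap (λ i → map (i ∷_) (box N n)) (upTo N) {f})
    (∑-cong (upTo N) λ i → ∑-map (i ∷_) (box N n) {f})

  ∑-box-single : ∀ N {n} (β : Vec ℕ n) {f : Vec ℕ n → Carrier} → deg β < N →
                 (∀ α → α ≢ β → f α ≈ 0#) → ∑ (box N n) f ≈ f β
  ∑-box-single N [] β<N f≈0 = +-identityʳ _
  ∑-box-single N {suc n} (b ∷ β) {f} β<N f≈0 = begin
    ∑ (box N (suc n)) f                                  ≈⟨ ∑-box-suc N n ⟩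
    ∑ (upTo N) (λ i → ∑ (box N n) (λ α → f (i ∷ α)))     ≈⟨ ∑-upTo-single N b (ℕ.≤-<-trans (ℕ.m≤m+n b (deg β)) β<N)
                                                            (λ i i≢b → ∑-zero (box N n) λ α → f≈0 (i ∷ α) λ { ≡.refl → i≢b ≡.refl }) ⟩
    ∑ (box N n) (λ α → f (b ∷ α))                        ≈⟨ ∑-box-single N β (ℕ.≤-<-trans (ℕ.m≤n+m (deg β) b) β<N)
                                                            (λ α α≢ → f≈0 (b ∷ α) λ { ≡.refl → α≢ ≡.refl }) ⟩
    f (b ∷ β)                                            ∎

  -- The right-hand side no longer mentions the decomposition, so a value depends on the
  -- coefficients alone. The claim is for all large `N` so that two representations can be compared
  -- on a common box.
  represents-∑ : ∀ {n} {x : Fin n → Carrier} {F v} → Represents x F v →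
                 ∃ λ M → ∀ N → M ≤ N → v ≈ ∑ (box N n) (λ α → F α * monomial x α)
  represents-∑ (mono β F0 v≈) = suc (deg β) , λ N β<N →
    trans v≈ (sym (∑-box-single N β β<N λ α α≢ → trans (*-congʳ (F0 α α≢)) (zeroˡ _)))
  represents-∑ {n} {x} (add r s F≈ v≈) with represents-∑ r | represents-∑ s
  ... | M , h | M' , h' = M ℕ.⊔ M' , λ N M⊔M'≤N → trans v≈ (trans
    (+-cong (h N (ℕ.≤-trans (ℕ.m≤m⊔n M M') M⊔M'≤N)) (h' N (ℕ.≤-trans (ℕ.m≤n⊔m M M') M⊔M'≤N)))
    (trans (sym (∑-+ (box N n))) (∑-cong (box N n) λ α →
      trans (sym (distribʳ _ _ _)) (*-congʳ (sym (F≈ α))))))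

  1^n≈1 : ∀ n → 1# ^ n ≈ 1#
  1^n≈1 zero = refl
  1^n≈1 (suc n) = trans (*-identityˡ _) (1^n≈1 n)

  cons1 : ∀ {n} → (Fin n → Carrier) → Fin (suc n) → Carrier
  cons1 x zero = 1#
  cons1 x (suc i) = x i

  -- Both values become sums over one box. At `X₀ = 1` the powers of `X₀` disappear, and summing
  -- `homCoeff e d (a ∷ α)` over `a` gives back `coeff e α`, since only `a = d − deg α` contributes.
  eval-dehomogenize : ∀ {n d} (e : Expr Carrier n) (h : Expr Carrier (suc n)) →
    (∀ α → d < deg α → coeff e α ≈ 0#) → (∀ β → homCoeff e d β ≈ coeff h β) →
    ∀ x → eval e x ≈ eval h (cons1 x)
  eval-dehomogenize {n} {d} e h e0 eq x
    with represents-∑ (represents-eval {x = x} e) | represents-∑ (represents-eval {x = cons1 x} h)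
  ... | M , he | M' , hh = begin
    eval e x                                               ≈⟨ he N (ℕ.≤-trans (ℕ.m≤m⊔n M M') (ℕ.m≤n+m _ _)) ⟩
    ∑ (box N n) (λ α → coeff e α * monomial x α)           ≈⟨ ∑-cong (box N n) (λ α → *-congʳ (sym (column α))) ⟩
    ∑ (box N n) (λ α → ∑ (upTo N) (λ a → hom a α) * monomial x α)
                                                           ≈⟨ ∑-cong (box N n) (λ α → ∑-*ʳ (upTo N)) ⟩
    ∑ (box N n) (λ α → ∑ (upTo N) (λ a → hom a α * monomial x α)) ≈⟨ ∑-comm (box N n) (upTo N) ⟩
    ∑ (upTo N) (λ a → ∑ (box N n) (λ α → hom a α * monomial x α))
      ≈⟨ ∑-cong (upTo N) (λ a → ∑-cong (box N n) λ α →
           *-cong (eq (a ∷ α)) (sym (trans (*-congʳ (1^n≈1 a)) (*-identityˡ _)))) ⟩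
    ∑ (upTo N) (λ a → ∑ (box N n) (λ α → coeff h (a ∷ α) * monomial (cons1 x) (a ∷ α))) ≈⟨ ∑-box-suc N n ⟨
    ∑ (box N (suc n)) (λ β → coeff h β * monomial (cons1 x) β) ≈⟨ hh N (ℕ.≤-trans (ℕ.m≤n⊔m M M') (ℕ.m≤n+m _ _)) ⟨
    eval h (cons1 x)                                       ∎
    where
    -- The summand `suc d` leaves room for the exponent `d ∸ deg α` of `X₀`; the maximum validates
    -- both representations.
    N = suc d ℕ.+ (M ℕ.⊔ M')
    hom = λ a α → homCoeff e d (a ∷ α)

    ∑-*ʳ : ∀ {A : Set} (l : List A) {f : A → Carrier} {c} → ∑ l f * c ≈ ∑ l (λ a → f a * c)
    ∑-*ʳ [] = zeroˡ _
    ∑-*ʳ (a ∷ l) = trans (distribʳ _ _ _) (+-congˡ (∑-*ʳ l))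

    hom-off : ∀ a α → a ℕ.+ deg α ≢ d → hom a α ≈ 0#
    hom-off a α ≢d with a ℕ.+ deg α ℕ.≡ᵇ d in eq
    ... | true = contradiction (ℕ.≡ᵇ⇒≡ _ _ (≡.subst Bool.T (≡.sym eq) tt)) ≢d
    ... | false = refl

    hom-on : ∀ a α → a ℕ.+ deg α ≡ d → hom a α ≈ coeff e α
    hom-on a α ≡d with a ℕ.+ deg α ℕ.≡ᵇ d in eq
    ... | true = refl
    ... | false = contradiction (≡.subst Bool.T eq (ℕ.≡⇒≡ᵇ _ _ ≡d)) λ ()

    column : ∀ α → ∑ (upTo N) (λ a → hom a α) ≈ coeff e α
    column α with deg α ℕ.≤? d
    ... | yes α≤d = trans
      (∑-upTo-single N (d ∸ deg α) (s≤s (ℕ.≤-trans (ℕ.m∸n≤m d (deg α)) (ℕ.m≤m+n d _)))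
        λ a a≢ → hom-off a α λ a+α≡d → a≢ (≡.trans (≡.sym (ℕ.m+n∸n≡m a (deg α))) (≡.cong (_∸ deg α) a+α≡d)))
      (hom-on (d ∸ deg α) α (ℕ.m∸n+n≡m α≤d))
    ... | no α≰d = trans (∑-zero (upTo N) λ a → hom-off a α λ a+α≡d → α≰d (ℕ.≤-trans (ℕ.m≤n+m (deg α) a) (ℕ.≤-reflexive a+α≡d)))
      (sym (e0 α (ℕ.≰⇒> α≰d)))

  -- Divisibility by `X₀`, read off the coefficients.
  NoTermFreeOfX₀ : ∀ {n} → Expr Carrier (suc n) → Set
  NoTermFreeOfX₀ e = ∀ α → coeff e (0 ∷ α) ≈ 0#

  free-⊗ˡ : ∀ {n} (e e' : Expr Carrier (suc n)) → NoTermFreeOfX₀ e → NoTermFreeOfX₀ (e ⊗ e')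
  free-⊗ˡ e e' e0 α = begin
    coeff (e ⊗ e') (0 ∷ α)                                    ≈⟨ coeff-⊗ e e' (0 ∷ α) ⟩
    conv (coeff e) (coeff e') (0 ∷ α)                         ≈⟨ conv-∷ (coeff e) (coeff e') 0 α ⟩
    conv (coeff e ∘ (0 ∷_)) (coeff e' ∘ (0 ∷_)) α + 0#        ≈⟨ +-identityʳ _ ⟩
    conv (coeff e ∘ (0 ∷_)) (coeff e' ∘ (0 ∷_)) α             ≈⟨ conv-zeroˡ e0 α ⟩
    0#                                                        ∎

  free-⊗ʳ : ∀ {n} (e e' : Expr Carrier (suc n)) → NoTermFreeOfX₀ e' → NoTermFreeOfX₀ (e ⊗ e')
  free-⊗ʳ e e' e'0 α = begin
    coeff (e ⊗ e') (0 ∷ α)                                    ≈⟨ coeff-⊗ e e' (0 ∷ α) ⟩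
    conv (coeff e) (coeff e') (0 ∷ α)                         ≈⟨ conv-∷ (coeff e) (coeff e') 0 α ⟩
    conv (coeff e ∘ (0 ∷_)) (coeff e' ∘ (0 ∷_)) α + 0#        ≈⟨ +-identityʳ _ ⟩
    conv (coeff e ∘ (0 ∷_)) (coeff e' ∘ (0 ∷_)) α             ≈⟨ conv-zeroʳ e'0 α ⟩
    0#                                                        ∎

  coeff-ΣE-zero : ∀ {m n} (f : Fin m → Expr Carrier n) α → (∀ i → coeff (f i) α ≈ 0#) → coeff (ΣE f) α ≈ 0#
  coeff-ΣE-zero {zero} f α f≈0 with allZero α
  ... | true = refl
  ... | false = refl
  coeff-ΣE-zero {suc m} f α f≈0 =
    trans (+-cong (f≈0 zero) (coeff-ΣE-zero (f ∘ suc) α (f≈0 ∘ suc))) (+-identityˡ 0#)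

  coeff-con-zero : ∀ {n c} → c ≈ 0# → (β : Vec ℕ n) → coeff (con c) β ≈ 0#
  coeff-con-zero c≈0 β with allZero β
  ... | true = c≈0
  ... | false = refl

  free-linForm : ∀ {n} (c : Fin (suc n) → Carrier) → (∀ i → c (suc i) ≈ 0#) → NoTermFreeOfX₀ (linForm c)
  free-linForm c c0 α = coeff-ΣE-zero (λ i → con (c i) ⊗ var i) (0 ∷ α) λ where
    zero → free-⊗ʳ (con (c zero)) (var zero) (λ _ → refl) α
    (suc i) → trans (coeff-⊗ (con (c (suc i))) (var (suc i)) (0 ∷ α)) (conv-zeroˡ (coeff-con-zero (c0 i)) (0 ∷ α))

-- Field homomorphisms acting on polynomials

module Homomorphism (K L : Field) {φ : Field.Carrier K → Field.Carrier L} (φ-hom : IsFieldHom K L φ) where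
  private
    module K = Field K
    module PK = Poly K
    module CK = Coefficients K
  open Field L hiding (zero)
  open Poly L
  open Coefficients L
  open RingMorphisms.IsRingHomomorphism φ-hom public
  open Relation.Binary.Reasoning.Setoid setoid

  -- A nonzero `x` has an inverse, so `φ x ≈ 0#` would give 1 = 0. The double negation stays because
  -- equality in `K` is not decidable here.
  injective₀ : ∀ {x} → φ x ≈ 0# → ¬ ¬ (x K.≈ K.0#)
  injective₀ {x} φx≈0 x≉0 with K.inverse x x≉0
  ... | y , xy≈1 = 1≉0 (begin
    1#              ≈⟨ 1#-homo ⟨
    φ K.1#          ≈⟨ ⟦⟧-cong xy≈1 ⟨
    φ (x K.* y)     ≈⟨ *-homo x y ⟩
    φ x * φ y       ≈⟨ *-congʳ φx≈0 ⟩
    0# * φ y        ≈⟨ zeroˡ _ ⟩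
    0#              ∎)

  φ-if : ∀ b {x} → φ (if b then x else K.0#) ≈ (if b then φ x else 0#)
  φ-if true = refl
  φ-if false = 0#-homo

  φ-∑ : ∀ {A : Set} (l : List A) {f} → φ (CK.∑ l f) ≈ ∑ l (φ ∘ f)
  φ-∑ [] = 0#-homo
  φ-∑ (a ∷ l) = trans (+-homo _ _) (+-congˡ (φ-∑ l))

  coeff-⊗-hom : ∀ {n} (e₁ e₂ : Expr K.Carrier n) (e₁' e₂' : Expr Carrier n) →
    (∀ α → φ (PK.coeff e₁ α) ≈ coeff e₁' α) → (∀ α → φ (PK.coeff e₂ α) ≈ coeff e₂' α) →
    ∀ α → φ (PK.coeff (e₁ ⊗ e₂) α) ≈ coeff (e₁' ⊗ e₂') α
  coeff-⊗-hom e₁ e₂ e₁' e₂' h₁ h₂ α = trans (φ-∑ (splits α))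
    (∑-cong (splits α) λ p → trans (*-homo _ _) (*-cong (h₁ _) (h₂ _)))

  coeff-con-hom : ∀ {n} c (α : Vec ℕ n) → φ (PK.coeff (con c) α) ≈ coeff (con (φ c)) α
  coeff-con-hom c α = φ-if (allZero α)

  coeff-var-hom : ∀ {n} i (α : Vec ℕ n) → φ (PK.coeff (var i) α) ≈ coeff (var i) α
  coeff-var-hom i α with isUnit i α
  ... | true = 1#-homo
  ... | false = 0#-homo

  coeff-hom : ∀ {n} (e : Expr K.Carrier n) α → φ (PK.coeff e α) ≈ coeff (mapExpr φ e) α
  coeff-hom (var i) = coeff-var-hom i
  coeff-hom (con c) = coeff-con-hom c
  coeff-hom (e ⊕ e') α = trans (+-homo _ _) (+-cong (coeff-hom e α) (coeff-hom e' α))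
  coeff-hom (e ⊗ e') = coeff-⊗-hom e e' (mapExpr φ e) (mapExpr φ e') (coeff-hom e) (coeff-hom e')
  coeff-hom (⊝ e) α = trans (-‿homo _) (-‿cong (coeff-hom e α))

  -- This is not an instance of `coeff-hom`: `mapExpr φ (linForm c)` ends in the image of zero under
  -- `φ`, whereas `linForm (φ ∘ c)` ends in `0#` itself.
  coeff-linForm-hom : ∀ {n} (c : Fin n → K.Carrier) α →
                      φ (PK.coeff (PK.linForm c) α) ≈ coeff (linForm (φ ∘ c)) α
  coeff-linForm-hom c α = go (λ i → con (c i) ⊗ var i) (λ i → con (φ (c i)) ⊗ var i)
    λ i → coeff-⊗-hom (con (c i)) (var i) (con (φ (c i))) (var i) (coeff-con-hom (c i)) (coeff-var-hom i) α
    where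
    go : ∀ {m} (f : Fin m → Expr K.Carrier _) (g : Fin m → Expr Carrier _) →
         (∀ i → φ (PK.coeff (f i) α) ≈ coeff (g i) α) → φ (PK.coeff (PK.ΣE f) α) ≈ coeff (ΣE g) α
    go {zero} f g h with allZero α
    ... | true = 0#-homo
    ... | false = 0#-homo
    go {suc m} f g h = trans (+-homo _ _) (+-cong (h zero) (go (f ∘ suc) (g ∘ suc) (h ∘ suc)))

  homCoeff-hom : ∀ {n} (e : Expr K.Carrier n) d β → φ (PK.homCoeff e d β) ≈ homCoeff (mapExpr φ e) d β
  homCoeff-hom e d (a ∷ α) = trans (φ-if (a ℕ.+ deg α ℕ.≡ᵇ d)) (if-cong (a ℕ.+ deg α ℕ.≡ᵇ d))
    where
    if-cong : ∀ b → (if b then φ (PK.coeff e α) else 0#) ≈ (if b then coeff (mapExpr φ e) α else 0#)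
    if-cong true = coeff-hom e α
    if-cong false = refl

  eval-hom : ∀ {n} (e : Expr K.Carrier n) x → φ (PK.eval e x) ≈ eval (mapExpr φ e) (φ ∘ x)
  eval-hom (var i) x = refl
  eval-hom (con c) x = refl
  eval-hom (e ⊕ e') x = trans (+-homo _ _) (+-cong (eval-hom e x) (eval-hom e' x))
  eval-hom (e ⊗ e') x = trans (*-homo _ _) (*-cong (eval-hom e x) (eval-hom e' x))
  eval-hom (⊝ e) x = trans (-‿homo _) (-‿cong (eval-hom e x))

module Evaluation (K : Field) where
  open Field K hiding (zero)
  open Poly K

  eval-cong : ∀ {n} (e : Expr Carrier n) {x y} → (∀ i → x i ≈ y i) → eval e x ≈ eval e y
  eval-cong (var i) x≈y = x≈y i
  eval-cong (con c) x≈y = refl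
  eval-cong (e ⊕ e') x≈y = +-cong (eval-cong e x≈y) (eval-cong e' x≈y)
  eval-cong (e ⊗ e') x≈y = *-cong (eval-cong e x≈y) (eval-cong e' x≈y)
  eval-cong (⊝ e) x≈y = -‿cong (eval-cong e x≈y)

  eval-map-sub : ∀ {A : Set} {m n} (φ : A → Carrier) (e : Expr A m) (s : Fin m → Expr A n) x {y} →
    (∀ i → eval (mapExpr φ (s i)) x ≈ y i) → eval (mapExpr φ (sub e s)) x ≈ eval (mapExpr φ e) y
  eval-map-sub φ (var i) s x h = h i
  eval-map-sub φ (con c) s x h = refl
  eval-map-sub φ (e ⊕ e') s x h = +-cong (eval-map-sub φ e s x h) (eval-map-sub φ e' s x h)
  eval-map-sub φ (e ⊗ e') s x h = *-cong (eval-map-sub φ e s x h) (eval-map-sub φ e' s x h)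
  eval-map-sub φ (⊝ e) s x h = -‿cong (eval-map-sub φ e s x h)

-- Binomial coefficients divisible by a prime

p∤k! : ∀ {p} → Prime p → ∀ k → k < p → ¬ (p ∣ k !)
p∤k! pr zero 0<p p∣1 = >⇒∤ (ℕ.nonTrivial⇒n>1 _ {{prime⇒nonTrivial pr}}) p∣1
p∤k! pr (suc k) k<p p∣k! with euclidsLemma (suc k) (k !) pr p∣k!
... | inj₁ p∣k = >⇒∤ k<p p∣k
... | inj₂ p∣k!′ = p∤k! pr k (ℕ.<⇒≤ k<p) p∣k!′

-- The prime divides p! = C(p, k) · k! · (p - k)! but neither factorial on the right.
p∣pCk : ∀ {p} → Prime p → ∀ k → 0 < k → k < p → p ∣ p ℕ.C k
p∣pCk {suc p-1} pr k 0<k k<p with euclidsLemma (p ℕ.C k) (k ! ℕ.* (p ∸ k) !) pr p∣prod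
  where
  p = suc p-1
  instance
    nz : NonZero (k ! ℕ.* (p ∸ k) !)
    nz = k ℕ.!* (p ∸ k) !≢0
  p∣prod : p ∣ (p ℕ.C k) ℕ.* (k ! ℕ.* (p ∸ k) !)
  p∣prod = ≡.subst (p ∣_)
    (≡.sym (≡.trans (≡.cong (ℕ._* (k ! ℕ.* (p ∸ k) !)) (nCk≡n!/k![n-k]! (ℕ.<⇒≤ k<p))) (m/n*n≡m (k![n∸k]!∣n! (ℕ.<⇒≤ k<p)))))
    (m∣m*n (p-1 !))
... | inj₁ p∣C = p∣C
... | inj₂ p∣ with euclidsLemma (k !) ((suc p-1 ∸ k) !) pr p∣
...   | inj₁ p∣k! = contradiction p∣k! (p∤k! pr k k<p)
...   | inj₂ p∣[p-k]! = contradiction p∣[p-k]! (p∤k! pr _ (ℕ.∸-monoʳ-< 0<k (ℕ.<⇒≤ k<p)))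

-- Zero divisors and the number of roots in a field

module FieldProperties (K : Field) where
  open Field K hiding (zero)
  open Algebra.Properties.Group +-group using (//-rightDividesˡ)
  open Algebra.Properties.Semiring.Exp semiring using (_^_)
  open Relation.Binary.Reasoning.Setoid setoid

  x*y≈0⇒y≈0 : ∀ {x y} → ¬ x ≈ 0# → x * y ≈ 0# → y ≈ 0#
  x*y≈0⇒y≈0 {x} {y} x≉0 xy≈0 with inverse x x≉0
  ... | x⁻¹ , xx⁻¹≈1 = begin
    y                ≈⟨ *-identityˡ y ⟨
    1# * y           ≈⟨ *-congʳ (trans (*-comm x⁻¹ x) xx⁻¹≈1) ⟨
    x⁻¹ * x * y      ≈⟨ *-assoc _ _ _ ⟩
    x⁻¹ * (x * y)    ≈⟨ *-congˡ xy≈0 ⟩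
    x⁻¹ * 0#         ≈⟨ zeroʳ _ ⟩
    0#               ∎

  *-nonzero : ∀ {x y} → ¬ x ≈ 0# → ¬ y ≈ 0# → ¬ x * y ≈ 0#
  *-nonzero x≉0 y≉0 xy≈0 = y≉0 (x*y≈0⇒y≈0 x≉0 xy≈0)

  ^-nonzero : ∀ {x} n → ¬ x ≈ 0# → ¬ x ^ n ≈ 0#
  ^-nonzero zero x≉0 = 1≉0
  ^-nonzero (suc n) x≉0 = *-nonzero x≉0 (^-nonzero n x≉0)

  x-y≈0⇒x≈y : ∀ {x y} → x - y ≈ 0# → x ≈ y
  x-y≈0⇒x≈y {x} {y} x-y≈0 = begin
    x              ≈⟨ //-rightDividesˡ y x ⟨
    x - y + y      ≈⟨ +-congʳ x-y≈0 ⟩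
    0# + y         ≈⟨ +-identityˡ y ⟩
    y              ∎

  x≈y⇒x-y≈0 : ∀ {x y} → x ≈ y → x - y ≈ 0#
  x≈y⇒x-y≈0 x≈y = trans (+-congʳ x≈y) (-‿inverseʳ _)

module RootBound (K : Field) where
  open Field K hiding (zero)
  open FieldProperties K
  open IntegerSolver commutativeRing
  open Algebra.Properties.Semiring.Exp semiring using (_^_)
  open Relation.Binary.Reasoning.Setoid setoid

  -- Functions with a Horner scheme of leading coefficient 1. The degree is an index, so it is known
  -- without testing any coefficient for zero.
  data Monic : ℕ → (Carrier → Carrier) → Set where
    one : ∀ {f} → (∀ t → f t ≈ 1#) → Monic 0 f
    horner : ∀ {n f g} c → Monic n g → (∀ t → f t ≈ t * g t + c) → Monic (suc n) f

  -- Synthetic division: if `h` is the quotient of `g` by t - r, then t·h + g(r) is the quotient of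
  -- t·g + c.
  divide : ∀ {n f} → Monic (suc n) f → ∀ r → ∃ λ g → Monic n g × (∀ t → f t ≈ (t - r) * g t + f r)
  divide {zero} {f} (horner c (one g≈1) f≈) r = (λ _ → 1#) , one (λ _ → refl) , λ t → begin
    f t                              ≈⟨ trans (f≈ t) (+-congʳ (*-congˡ (g≈1 t))) ⟩
    t * 1# + c                       ≈⟨ solve 3 (λ t r c → t :* con (+ 1) :+ c := (t :- r) :* con (+ 1) :+ (r :* con (+ 1) :+ c)) refl t r c ⟩
    (t - r) * 1# + (r * 1# + c)      ≈⟨ +-congˡ (trans (f≈ r) (+-congʳ (*-congˡ (g≈1 r)))) ⟨
    (t - r) * 1# + f r               ∎
  divide {suc n} {f} (horner {g = g} c mg f≈) r with divide mg r
  ... | h , mh , g≈ = (λ t → t * h t + g r) , horner (g r) mh (λ _ → refl) , λ t → begin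
    f t                                          ≈⟨ trans (f≈ t) (+-congʳ (*-congˡ (g≈ t))) ⟩
    t * ((t - r) * h t + g r) + c                ≈⟨ solve 5 (λ t r h g c → t :* ((t :- r) :* h :+ g) :+ c := (t :- r) :* (t :* h :+ g) :+ (r :* g :+ c)) refl t r (h t) (g r) c ⟩
    (t - r) * (t * h t + g r) + (r * g r + c)    ≈⟨ +-congˡ (f≈ r) ⟨
    (t - r) * (t * h t + g r) + f r              ∎

  monic-roots : ∀ {n f} → Monic n f → (r : Fin (suc n) → Carrier) →
                (∀ i j → r i ≈ r j → i ≡ j) → ¬ (∀ i → f (r i) ≈ 0#)
  monic-roots (one f≈1) r r-inj roots = 1≉0 (trans (sym (f≈1 _)) (roots zero))
  monic-roots {suc n} {f} mf r r-inj roots with divide mf (r zero)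
  ... | g , mg , f≈ = monic-roots mg (r ∘ suc) (λ i j → Fin.suc-injective ∘ r-inj (suc i) (suc j)) λ i →
    x*y≈0⇒y≈0 (λ ri-r0≈0 → contradiction (r-inj (suc i) zero (x-y≈0⇒x≈y ri-r0≈0)) λ ())
      (begin
        (r (suc i) - r zero) * g (r (suc i))               ≈⟨ +-identityʳ _ ⟨
        (r (suc i) - r zero) * g (r (suc i)) + 0#          ≈⟨ +-congˡ (roots zero) ⟨
        (r (suc i) - r zero) * g (r (suc i)) + f (r zero)  ≈⟨ f≈ _ ⟨
        f (r (suc i))                                      ≈⟨ roots (suc i) ⟩
        0#                                                 ∎)

  monic-^ : ∀ n → Monic n (_^ n)
  monic-^ zero = one (λ _ → refl)
  monic-^ (suc n) = horner 0# (monic-^ n) (λ _ → sym (+-identityʳ _))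

  -- The exponent starts at 2, where the power dominates the subtracted `t`.
  monic-^-t : ∀ n → Monic (suc (suc n)) (λ t → t ^ suc (suc n) - t)
  monic-^-t n = horner 0# (horner (- 1#) (monic-^ n) (λ _ → refl)) λ t →
    solve 2 (λ t u → t :* (t :* u) :- t := t :* (t :* u :+ con (-[1+ 0 ])) :+ con (+ 0)) refl t (t ^ n)

-- The Frobenius homomorphism

module FreshmansDream (K : Field) {p : ℕ} (p-prime : Prime p) where
  open Field K hiding (zero)
  open Algebra.Properties.Semiring.Exp semiring
  open Algebra.Properties.CommutativeSemiring.Exp commutativeSemiring using (^-distrib-*)
  open Algebra.Properties.Semiring.Mult semiring renaming (_×_ to _·_)
  open Algebra.Properties.CommutativeSemiring.Binomial commutativeSemiring using (theorem; binomialTerm)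
  open Algebra.Properties.CommutativeMonoid.Sum +-commutativeMonoid
  open Relation.Binary.Reasoning.Setoid setoid

  module _ (p·1≈0 : p · 1# ≈ 0#) where

    p·x≈0 : ∀ x → p · x ≈ 0#
    p·x≈0 x = begin
      p · x           ≈⟨ ×-congʳ p (*-identityˡ x) ⟨
      p · (1# * x)    ≈⟨ ×-assoc-* p 1# x ⟨
      p · 1# * x      ≈⟨ *-congʳ p·1≈0 ⟩
      0# * x          ≈⟨ zeroˡ x ⟩
      0#              ∎

    ∣⇒·≈0 : ∀ {n} x → p ∣ n → n · x ≈ 0#
    ∣⇒·≈0 x (divides c ≡.refl) = trans (sym (×-assocˡ x c p)) (trans (×-congʳ c (p·x≈0 x)) (n·0≈0 c))
      where
      n·0≈0 : ∀ n → n · 0# ≈ 0#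
      n·0≈0 zero = refl
      n·0≈0 (suc n) = trans (+-identityˡ _) (n·0≈0 n)

    ^p-+ : ∀ x y → (x + y) ^ p ≈ x ^ p + y ^ p
    ^p-+ x y = go p p-prime ≡.refl
      where
      -- The exponent is generalized so that it can be matched as a successor, which splits off both
      -- ends of the binomial sum.
      go : ∀ p′ → Prime p′ → p′ ≡ p → (x + y) ^ p′ ≈ x ^ p′ + y ^ p′
      go (suc n) pr ≡.refl = begin
        (x + y) ^ suc n                      ≈⟨ theorem (suc n) x y ⟩
        term zero + sum (term ∘ suc)         ≈⟨ +-congˡ (sum-init-last (term ∘ suc)) ⟩
        term zero + (sum (λ i → term (suc (Fin.inject₁ i))) + term (suc (Fin.fromℕ n)))
          ≈⟨ +-cong first (+-cong middle last) ⟩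
        y ^ suc n + (0# + x ^ suc n)         ≈⟨ +-congˡ (+-identityˡ _) ⟩
        y ^ suc n + x ^ suc n                ≈⟨ +-comm _ _ ⟩
        x ^ suc n + y ^ suc n                ∎
        where
        term = binomialTerm x y (suc n)
        first : term zero ≈ y ^ suc n
        first = trans (×-homo-1 _) (*-identityˡ _)
        middle : sum (λ i → term (suc (Fin.inject₁ i))) ≈ 0#
        middle = trans (sum-cong-≋ λ i → ∣⇒·≈0 _ (p∣pCk pr (suc (toℕ (Fin.inject₁ i))) (s≤s z≤n)
            (s≤s (≡.subst (_< n) (≡.sym (Fin.toℕ-inject₁ i)) (Fin.toℕ<n i)))))
          (sum-replicate-zero n)
        last : term (suc (Fin.fromℕ n)) ≈ x ^ suc n
        last rewrite Fin.toℕ-fromℕ n | nCn≡1 (suc n) | ℕ.n∸n≡0 n = trans (×-homo-1 _) (*-identityʳ _)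

    ^p^k-+ : ∀ k x y → (x + y) ^ (p ℕ.^ k) ≈ x ^ (p ℕ.^ k) + y ^ (p ℕ.^ k)
    ^p^k-+ zero x y = trans (*-identityʳ _) (sym (+-cong (*-identityʳ _) (*-identityʳ _)))
    ^p^k-+ (suc k) x y = begin
      (x + y) ^ (p ℕ.* p ℕ.^ k)                         ≈⟨ ^-assocʳ (x + y) p (p ℕ.^ k) ⟨
      ((x + y) ^ p) ^ (p ℕ.^ k)                         ≈⟨ ^-congˡ (p ℕ.^ k) (^p-+ x y) ⟩
      (x ^ p + y ^ p) ^ (p ℕ.^ k)                       ≈⟨ ^p^k-+ k (x ^ p) (y ^ p) ⟩
      (x ^ p) ^ (p ℕ.^ k) + (y ^ p) ^ (p ℕ.^ k)         ≈⟨ +-cong (^-assocʳ x p (p ℕ.^ k)) (^-assocʳ y p (p ℕ.^ k)) ⟩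
      x ^ (p ℕ.* p ℕ.^ k) + y ^ (p ℕ.* p ℕ.^ k)         ∎

    frobenius : ∀ k {q} → q ≡ p ℕ.^ k → 0 < q → IsFieldHom K K (_^ q)
    frobenius k {q} ≡.refl 0<q = record
      { isSemiringHomomorphism = record
        { isNearSemiringHomomorphism = record
          { +-isMonoidHomomorphism = record
            { isMagmaHomomorphism = record
              { isRelHomomorphism = record { cong = ^-congˡ q } ; homo = ^p^k-+ k }
            ; ε-homo = 0^q≈0 0<q }
          ; *-homo = λ x y → ^-distrib-* x y q }
        ; 1#-homo = Coefficients.1^n≈1 K q }
      ; -‿homo = λ x → inverseˡ-unique _ _ (trans (sym (^p^k-+ k (- x) x)) (trans (^-congˡ q (-‿inverseˡ x)) (0^q≈0 0<q))) }
      where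
      open Algebra.Properties.Group +-group using (inverseˡ-unique)
      0^q≈0 : ∀ {q} → 0 < q → 0# ^ q ≈ 0#
      0^q≈0 {suc q} _ = zeroˡ _

-- Finite fields: characteristic, Fermat's identity, fixed points of Frobenius

module FiniteField (F : Field) {q : ℕ} (size : HasSize F q) where
  open Field F hiding (zero)
  open FieldProperties F
  open IntegerSolver commutativeRing
  open Algebra.Properties.Semiring.Exp semiring
  open Algebra.Properties.Semiring.Mult semiring renaming (_×_ to _·_)
  open Algebra.Properties.Group +-group using (identityʳ-unique)
  open Relation.Binary.Reasoning.Setoid setoid
  private
    module Sum = Algebra.Properties.CommutativeMonoid.Sum +-commutativeMonoid
    module Prod = Algebra.Properties.CommutativeMonoid.Sum *-commutativeMonoid

  element : Fin q → Carrier
  element = proj₁ size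

  element-injective : ∀ i j → element i ≈ element j → i ≡ j
  element-injective = proj₁ (proj₂ size)

  index : Carrier → Fin q
  index x = proj₁ (proj₂ (proj₂ size) x)

  element-index : ∀ x → element (index x) ≈ x
  element-index x = proj₂ (proj₂ (proj₂ size) x)

  infix 4 _≟_
  _≟_ : ∀ x y → Dec (x ≈ y)
  x ≟ y = Dec.map′
    (λ i≡j → trans (sym (element-index x)) (trans (reflexive (≡.cong element i≡j)) (element-index y)))
    (λ x≈y → element-injective _ _ (trans (element-index x) (trans x≈y (sym (element-index y)))))
    (index x Fin.≟ index y)

  bijection : (f g : Carrier → Carrier) → (∀ {x y} → x ≈ y → f x ≈ f y) → (∀ {x y} → x ≈ y → g x ≈ g y) →
              (∀ x → f (g x) ≈ x) → (∀ x → g (f x) ≈ x) → Permutation q q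
  bijection f g f-cong g-cong fg gf = permutation (λ i → index (f (element i))) (λ i → index (g (element i)))
    (λ i → element-injective _ _ (trans (element-index _) (trans (f-cong (element-index _)) (fg _))))
    (λ i → element-injective _ _ (trans (element-index _) (trans (g-cong (element-index _)) (gf _))))

  -- Translation by 1 permutes the elements, so their sum S satisfies S = S + q·1.
  q·1≈0 : q · 1# ≈ 0#
  q·1≈0 = identityʳ-unique (Sum.sum element) (q · 1#) (sym (begin
    Sum.sum element                             ≈⟨ Sum.sum-permute element shift ⟩
    Sum.sum (λ i → element (shift ⟨$⟩ʳ i))      ≈⟨ Sum.sum-cong-≋ {q} (λ i → element-index (element i + 1#)) ⟩
    Sum.sum (λ i → element i + 1#)              ≈⟨ Sum.∑-distrib-+ element (λ _ → 1#) ⟩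
    Sum.sum element + Sum.sum {q} (λ _ → 1#)    ≈⟨ +-congˡ (Sum.sum-replicate q) ⟩
    Sum.sum element + q · 1#                    ∎))
    where
    shift = bijection (_+ 1#) (_- 1#) +-congʳ +-congʳ
      (solve 1 (λ x → x :- con (+ 1) :+ con (+ 1) := x) refl) (solve 1 (λ x → x :+ con (+ 1) :- con (+ 1) := x) refl)

  -- Here 0 = q·1 = (p·1)^k, and a power of a nonzero element is nonzero.
  characteristic : ∀ {p} k → q ≡ p ℕ.^ k → p · 1# ≈ 0#
  characteristic {p} k ≡.refl with p · 1# ≟ 0#
  ... | yes p≈0 = p≈0
  ... | no p≉0 = contradiction (trans (sym (·1-^ k)) q·1≈0) (^-nonzero k p≉0)
    where
    ·1-^ : ∀ k → (p ℕ.^ k) · 1# ≈ (p · 1#) ^ k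
    ·1-^ zero = ×-homo-1 1#
    ·1-^ (suc k) = trans (×1-homo-* p (p ℕ.^ k)) (*-congˡ (·1-^ k))

  ∏-single : ∀ {n} (t : Fin n → Carrier) i → (∀ j → j ≢ i → t j ≈ 1#) → Prod.sum t ≈ t i
  ∏-single {suc n} t i t≈1 = begin
    Prod.sum t                                    ≈⟨ Prod.sum-remove {i = i} t ⟩
    t i * Prod.sum (λ j → t (punchIn i j))        ≈⟨ *-congˡ (Prod.sum-cong-≋ λ j → t≈1 _ (Fin.punchInᵢ≢i i j)) ⟩
    t i * Prod.sum {n} (λ _ → 1#)                 ≈⟨ *-congˡ (Prod.sum-replicate-zero n) ⟩
    t i * 1#                                      ≈⟨ *-identityʳ _ ⟩
    t i                                           ∎

  ∏-nonzero : ∀ {n} (t : Fin n → Carrier) → (∀ i → ¬ t i ≈ 0#) → ¬ Prod.sum t ≈ 0#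
  ∏-nonzero {zero} t t≉0 = 1≉0
  ∏-nonzero {suc n} t t≉0 = *-nonzero (t≉0 zero) (∏-nonzero (t ∘ suc) (t≉0 ∘ suc))

  ∏-const : ∀ n a → Prod.sum {n} (λ _ → a) ≈ a ^ n
  ∏-const zero a = refl
  ∏-const (suc n) a = *-congˡ (∏-const n a)

  module _ {a : Carrier} (a≉0 : ¬ a ≈ 0#) where
    ifZero_then_else_ : Carrier → Carrier → Carrier → Carrier
    ifZero x then u else v with x ≟ 0#
    ... | yes _ = u
    ... | no _ = v

    ifZero-no : ∀ {x u v} → ¬ x ≈ 0# → ifZero x then u else v ≈ v
    ifZero-no {x} x≉0 with x ≟ 0#
    ... | yes x≈0 = contradiction x≈0 x≉0
    ... | no _ = refl

    ifZero-yes : ∀ {x u v} → x ≈ 0# → ifZero x then u else v ≈ u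
    ifZero-yes {x} x≈0 with x ≟ 0#
    ... | yes _ = refl
    ... | no x≉0 = contradiction x≈0 x≉0

    -- With 0 replaced by 1, the product over all elements equals the product of the nonzero ones,
    -- and the units need no enumeration of their own.
    unitPart : Carrier → Carrier
    unitPart x = ifZero x then 1# else x

    unitPart-nonzero : ∀ x → ¬ unitPart x ≈ 0#
    unitPart-nonzero x with x ≟ 0#
    ... | yes _ = 1≉0
    ... | no x≉0 = x≉0

    unitPart-* : ∀ {x y} → y ≈ a * x → unitPart y ≈ (ifZero x then 1# else a) * unitPart x
    unitPart-* {x} {y} y≈ax with x ≟ 0#
    ... | yes x≈0 = trans (ifZero-yes (trans y≈ax (trans (*-congˡ x≈0) (zeroʳ a)))) (sym (*-identityˡ 1#))
    ... | no x≉0 = trans (ifZero-no λ y≈0 → *-nonzero a≉0 x≉0 (trans (sym y≈ax) y≈0)) y≈ax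

    private
      a⁻¹ = proj₁ (inverse a a≉0)
      aa⁻¹≈1 = proj₂ (inverse a a≉0)

      scaling : Permutation q q
      scaling = bijection (a *_) (a⁻¹ *_) *-congˡ *-congˡ
        (λ x → trans (sym (*-assoc _ _ _)) (trans (*-congʳ aa⁻¹≈1) (*-identityˡ x)))
        (λ x → trans (sym (*-assoc _ _ _)) (trans (*-congʳ (trans (*-comm _ _) aa⁻¹≈1)) (*-identityˡ x)))

      H = Prod.sum (unitPart ∘ element)
      -- This is a^(q-1): a product of q factors in which the one at the zero element is 1.
      A = Prod.sum (λ i → ifZero element i then 1# else a)

      H≈AH : H ≈ A * H
      H≈AH = begin
        H                                                   ≈⟨ Prod.sum-permute (unitPart ∘ element) scaling ⟩
        Prod.sum (λ i → unitPart (element (scaling ⟨$⟩ʳ i)))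
          ≈⟨ Prod.sum-cong-≋ (λ i → unitPart-* (element-index (a * element i))) ⟩
        Prod.sum (λ i → (ifZero element i then 1# else a) * unitPart (element i))
          ≈⟨ Prod.∑-distrib-+ (λ i → ifZero element i then 1# else a) (unitPart ∘ element) ⟩
        A * H                                               ∎

      A≈1 : A ≈ 1#
      A≈1 = x-y≈0⇒x≈y (x*y≈0⇒y≈0 (∏-nonzero _ (unitPart-nonzero ∘ element))
        (trans (solve 2 (λ h a → h :* (a :- con (+ 1)) := a :* h :- h) refl H A) (x≈y⇒x-y≈0 (sym H≈AH))))

    -- Multiplication by `a` permutes the nonzero elements, whence `A≈1`. The product of q copies of
    -- `a` is `A` times the single copy that sits at the zero element.
    fermat-nonzero : a ^ q ≈ a
    fermat-nonzero = begin
      a ^ q                                   ≈⟨ ∏-const q a ⟨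
      Prod.sum {q} (λ _ → a)                  ≈⟨ Prod.sum-cong-≋ (λ i → split (element i)) ⟩
      Prod.sum (λ i → (ifZero element i then 1# else a) * (ifZero element i then a else 1#))
        ≈⟨ Prod.∑-distrib-+ (λ i → ifZero element i then 1# else a) (λ i → ifZero element i then a else 1#) ⟩
      A * Prod.sum (λ i → ifZero element i then a else 1#)
        ≈⟨ *-cong A≈1 (∏-single _ (index 0#) λ j j≢ → ifZero-no λ ej≈0 →
             j≢ (element-injective _ _ (trans ej≈0 (sym (element-index 0#))))) ⟩
      1# * (ifZero element (index 0#) then a else 1#) ≈⟨ trans (*-identityˡ _) (ifZero-yes (element-index 0#)) ⟩
      a                                       ∎
      where
      split : ∀ x → a ≈ (ifZero x then 1# else a) * (ifZero x then a else 1#)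
      split x with x ≟ 0#
      ... | yes _ = sym (*-identityˡ a)
      ... | no _ = sym (*-identityʳ a)

  fermat : 0 < q → ∀ a → a ^ q ≈ a
  fermat 0<q a with a ≟ 0#
  ... | no a≉0 = fermat-nonzero a≉0
  ... | yes a≈0 = trans (^-congˡ q a≈0) (trans (0^q≈0 0<q) (sym a≈0))
    where
    0^q≈0 : ∀ {q} → 0 < q → 0# ^ q ≈ 0#
    0^q≈0 {suc q} _ = zeroˡ _

  module _ {K : Field} {φ : Carrier → Field.Carrier K} (φ-hom : IsFieldHom F K φ) where
    private module K = Field K
    open Homomorphism F K φ-hom using (injective₀; +-homo; -‿homo)
    open Algebra.Properties.Semiring.Exp K.semiring using () renaming (_^_ to _^ᴷ_)

    φ-injective : ∀ {x y} → φ x K.≈ φ y → x ≈ y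
    φ-injective {x} {y} φx≈φy = Dec.decidable-stable (x ≟ y) λ x≉y → injective₀ {x = x - y}
      (K.trans (+-homo _ _) (K.trans (K.+-congˡ (-‿homo y)) (FieldProperties.x≈y⇒x-y≈0 K φx≈φy))) (x≉y ∘ x-y≈0⇒x≈y)

    φ-^ : ∀ x n → φ (x ^ n) K.≈ φ x ^ᴷ n
    φ-^ x zero = Homomorphism.1#-homo F K φ-hom
    φ-^ x (suc n) = K.trans (Homomorphism.*-homo F K φ-hom _ _) (K.*-congˡ (φ-^ x n))

    φ-· : ∀ n → φ (n · 1#) K.≈ Algebra.Properties.Semiring.Mult._×_ K.semiring n K.1#
    φ-· zero = Homomorphism.0#-homo F K φ-hom
    φ-· (suc n) = K.trans (+-homo _ _) (K.+-cong (Homomorphism.1#-homo F K φ-hom) (φ-· n))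

    -- The q elements of the image are already roots of t^q - t; a fixed `z` outside the image would
    -- be one root too many.
    fixed⇒image : 1 < q → ∀ {z} → z ^ᴷ q K.≈ z → ¬ ¬ (∃ λ a → φ a K.≈ z)
    fixed⇒image 1<q {z} z^q≈z none = RootBound.monic-roots K (monic 1<q) root root-injective root-zero
      where
      monic : ∀ {q} → 1 < q → RootBound.Monic K q (λ t → t ^ᴷ q K.- t)
      monic {suc (suc n)} _ = RootBound.monic-^-t K n
      monic {suc zero} (s≤s ())

      root : Fin (suc q) → K.Carrier
      root zero = z
      root (suc i) = φ (element i)

      root-injective : ∀ i j → root i K.≈ root j → i ≡ j
      root-injective zero zero _ = ≡.refl
      root-injective zero (suc j) z≈φ = contradiction (element j , K.sym z≈φ) none
      root-injective (suc i) zero φ≈z = contradiction (element i , φ≈z) none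
      root-injective (suc i) (suc j) φ≈φ = ≡.cong suc (element-injective i j (φ-injective φ≈φ))

      root-zero : ∀ i → (root i ^ᴷ q K.- root i) K.≈ K.0#
      root-zero zero = FieldProperties.x≈y⇒x-y≈0 K z^q≈z
      root-zero (suc i) = FieldProperties.x≈y⇒x-y≈0 K
        (K.trans (K.sym (φ-^ (element i) q)) (Homomorphism.⟦⟧-cong F K φ-hom (fermat (ℕ.<-trans (s≤s z≤n) 1<q) (element i))))

-- A generator of the quadric through two points

module Generator (F : Field) where
  open Field F hiding (zero)
  open Poly F
  open Geometry F
  open Construction F
  open FieldProperties F
  open IntegerSolver commutativeRing

  -- The span of e₀ and the graph of u ↦ n × u, where the coordinates 1,2,3 and 6,5,4
  -- are dual to each other under Q; it is totally singular because u · (n × u) = 0.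
  graph : (n₁ n₂ n₃ : Carrier) → Fin 4 → Vec8
  graph n₁ n₂ n₃ 0F = lookup (1# ∷ 0# ∷ 0# ∷ 0# ∷ 0# ∷ 0# ∷ 0# ∷ 0# ∷ [])
  graph n₁ n₂ n₃ 1F = lookup (0# ∷ 1# ∷ 0# ∷ 0# ∷ - n₂ ∷ n₃ ∷ 0# ∷ 0# ∷ [])
  graph n₁ n₂ n₃ 2F = lookup (0# ∷ 0# ∷ 1# ∷ 0# ∷ n₁ ∷ 0# ∷ - n₃ ∷ 0# ∷ [])
  graph n₁ n₂ n₃ 3F = lookup (0# ∷ 0# ∷ 0# ∷ 1# ∷ 0# ∷ - n₁ ∷ n₂ ∷ 0# ∷ [])

  private
    I O : ∀ {n} → Polynomial n
    I = con (+ 1)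
    O = con (+ 0)

  graph-point : ∀ n₁ n₂ n₃ l k → comb l (graph n₁ n₂ n₃) k ≈
    lookup (l 0F ∷ l 1F ∷ l 2F ∷ l 3F ∷ n₁ * l 2F - n₂ * l 1F ∷ n₃ * l 1F - n₁ * l 3F ∷ n₂ * l 3F - n₃ * l 2F ∷ 0# ∷ []) k
  graph-point n₁ n₂ n₃ l = λ where
      0F → solve 4 (λ a b c d → a :* I :+ b :* O :+ c :* O :+ d :* O := a) refl (l 0F) (l 1F) (l 2F) (l 3F)
      1F → solve 4 (λ a b c d → a :* O :+ b :* I :+ c :* O :+ d :* O := b) refl (l 0F) (l 1F) (l 2F) (l 3F)
      2F → solve 4 (λ a b c d → a :* O :+ b :* O :+ c :* I :+ d :* O := c) refl (l 0F) (l 1F) (l 2F) (l 3F)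
      3F → solve 4 (λ a b c d → a :* O :+ b :* O :+ c :* O :+ d :* I := d) refl (l 0F) (l 1F) (l 2F) (l 3F)
      4F → solve 6 (λ a b c d m n → a :* O :+ b :* (:- n) :+ c :* m :+ d :* O := m :* c :- n :* b) refl (l 0F) (l 1F) (l 2F) (l 3F) n₁ n₂
      5F → solve 6 (λ a b c d m n → a :* O :+ b :* m :+ c :* O :+ d :* (:- n) := m :* b :- n :* d) refl (l 0F) (l 1F) (l 2F) (l 3F) n₃ n₁
      6F → solve 6 (λ a b c d m n → a :* O :+ b :* O :+ c :* (:- n) :+ d :* m := m :* d :- n :* c) refl (l 0F) (l 1F) (l 2F) (l 3F) n₂ n₃
      7F → solve 4 (λ a b c d → a :* O :+ b :* O :+ c :* O :+ d :* O := O) refl (l 0F) (l 1F) (l 2F) (l 3F)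

  graph-isGenerator : ∀ n₁ n₂ n₃ → IsGeneratorBasis (graph n₁ n₂ n₃)
  graph-isGenerator n₁ n₂ n₃ = independent , singular
    where
    independent : LinIndep (graph n₁ n₂ n₃)
    independent l l≈0 0F = trans (sym (graph-point n₁ n₂ n₃ l 0F)) (l≈0 0F)
    independent l l≈0 1F = trans (sym (graph-point n₁ n₂ n₃ l 1F)) (l≈0 1F)
    independent l l≈0 2F = trans (sym (graph-point n₁ n₂ n₃ l 2F)) (l≈0 2F)
    independent l l≈0 3F = trans (sym (graph-point n₁ n₂ n₃ l 3F)) (l≈0 3F)

    singular : ∀ l → Q (comb l (graph n₁ n₂ n₃)) ≈ 0#
    singular l = trans
      (+-cong (+-cong (+-cong (*-cong (pt 0F) (pt 7F)) (*-cong (pt 1F) (pt 6F))) (*-cong (pt 2F) (pt 5F))) (*-cong (pt 3F) (pt 4F)))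
      (solve 7 (λ a x y z n₁ n₂ n₃ →
        a :* O :+ x :* (n₂ :* z :- n₃ :* y) :+ y :* (n₃ :* x :- n₁ :* z) :+ z :* (n₁ :* y :- n₂ :* x) := O)
        refl (l 0F) (l 1F) (l 2F) (l 3F) n₁ n₂ n₃)
      where pt = graph-point n₁ n₂ n₃ l

  -- A vector n with n × (x, y, z) = (v₃, v₂, v₁), which is what places the point with parameter (x,
  -- y, z) in the span of `graph n₁ n₂ n₃`.
  record CrossQuotient (x y z v₁ v₂ v₃ : Carrier) : Set where
    field
      n₁ n₂ n₃ : Carrier
      eq₁ : v₁ ≈ n₁ * y - n₂ * x
      eq₂ : v₂ ≈ n₃ * x - n₁ * z
      eq₃ : v₃ ≈ n₂ * z - n₃ * y

  private
    scale : ∀ {x i v w} → x * i ≈ 1# → x * i * v ≈ w → v ≈ w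
    scale xi≈1 eq = trans (sym (trans (*-congʳ xi≈1) (*-identityˡ _))) eq

    scale₀ : ∀ {x i v w s} → x * i ≈ 1# → s ≈ 0# → x * i * v ≈ s * i + w → v ≈ w
    scale₀ xi≈1 s≈0 eq = scale xi≈1 (trans eq (trans (+-congʳ (trans (*-congʳ s≈0) (zeroˡ _))) (+-identityˡ _)))

  -- Adding a multiple of (x, y, z) to n does not change the cross product, so the component of n at
  -- the nonzero coordinate can be taken as 0. Two equations then give the other components by
  -- division, and the third is the orthogonality relation.
  crossQuotient : ∀ {x y z v₁ v₂ v₃} → x * v₃ + y * v₂ + z * v₁ ≈ 0# →
    ∀ k → ¬ lookup (x ∷ y ∷ z ∷ []) k ≈ 0# → CrossQuotient x y z v₁ v₂ v₃
  crossQuotient {x} {y} {z} {v₁} {v₂} {v₃} s≈0 0F x≉0 with inverse x x≉0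
  ... | i , xi≈1 = record
    { n₁ = 0# ; n₂ = - (v₁ * i) ; n₃ = v₂ * i
    ; eq₁ = scale xi≈1 (solve 4 (λ x y i v → x :* i :* v := O :* y :- :- (v :* i) :* x) refl x y i v₁)
    ; eq₂ = scale xi≈1 (solve 4 (λ x z i v → x :* i :* v := v :* i :* x :- O :* z) refl x z i v₂)
    ; eq₃ = scale₀ xi≈1 s≈0 (solve 7 (λ x y z i v₁ v₂ v₃ → x :* i :* v₃ :=
        (x :* v₃ :+ y :* v₂ :+ z :* v₁) :* i :+ (:- (v₁ :* i) :* z :- v₂ :* i :* y)) refl x y z i v₁ v₂ v₃) }
  crossQuotient {x} {y} {z} {v₁} {v₂} {v₃} s≈0 1F y≉0 with inverse y y≉0
  ... | i , yi≈1 = record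
    { n₁ = v₁ * i ; n₂ = 0# ; n₃ = - (v₃ * i)
    ; eq₁ = scale yi≈1 (solve 4 (λ y x i v → y :* i :* v := v :* i :* y :- O :* x) refl y x i v₁)
    ; eq₂ = scale₀ yi≈1 s≈0 (solve 7 (λ x y z i v₁ v₂ v₃ → y :* i :* v₂ :=
        (x :* v₃ :+ y :* v₂ :+ z :* v₁) :* i :+ (:- (v₃ :* i) :* x :- v₁ :* i :* z)) refl x y z i v₁ v₂ v₃)
    ; eq₃ = scale yi≈1 (solve 4 (λ y z i v → y :* i :* v := O :* z :- :- (v :* i) :* y) refl y z i v₃) }
  crossQuotient {x} {y} {z} {v₁} {v₂} {v₃} s≈0 2F z≉0 with inverse z z≉0
  ... | i , zi≈1 = record
    { n₁ = - (v₂ * i) ; n₂ = v₃ * i ; n₃ = 0#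
    ; eq₁ = scale₀ zi≈1 s≈0 (solve 7 (λ x y z i v₁ v₂ v₃ → z :* i :* v₁ :=
        (x :* v₃ :+ y :* v₂ :+ z :* v₁) :* i :+ (:- (v₂ :* i) :* y :- v₃ :* i :* x)) refl x y z i v₁ v₂ v₃)
    ; eq₂ = scale zi≈1 (solve 4 (λ z x i v → z :* i :* v := O :* x :- :- (v :* i) :* z) refl z x i v₂)
    ; eq₃ = scale zi≈1 (solve 4 (λ z y i v → z :* i :* v := v :* i :* z :- O :* y) refl z y i v₃) }

  module _ (f₁ f₂ f₃ : Expr Carrier 3)
    (f₁0 : eval f₁ (λ _ → 0#) ≈ 0#) (f₂0 : eval f₂ (λ _ → 0#) ≈ 0#) (f₃0 : eval f₃ (λ _ → 0#) ≈ 0#) where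

    -- Since the `fᵢ` vanish at 0, the point with parameter 0 is e₀, which lies in every `graph`;
    -- orthogonality puts the point with parameter u into a suitable one. If the two points
    -- coincided, coordinates 1 to 3 would give u = 0.
    perpendicular⇒¬ovoid : ∀ x y z → let u = lookup (x ∷ y ∷ z ∷ []) in
      ∀ k → ¬ u k ≈ 0# → x * eval f₃ u + y * eval f₂ u + z * eval f₁ u ≈ 0# → ¬ IsOvoid (O₇ f₁ f₂ f₃)
    perpendicular⇒¬ovoid x y z k u≉0 s≈0 (_ , generators) = u≉0 (u≈0 k)
      where
      u = lookup (x ∷ y ∷ z ∷ [])
      open CrossQuotient (crossQuotient {v₁ = eval f₁ u} {eval f₂ u} {eval f₃ u} s≈0 k u≉0)

      origin : Carrier × Carrier × Carrier
      origin = 0# , 0# , 0#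

      f-origin : ∀ f → eval f (λ _ → 0#) ≈ 0# → eval f (lookup (0# ∷ 0# ∷ 0# ∷ [])) ≈ 0#
      f-origin f f0 = trans (Evaluation.eval-cong F f λ { 0F → refl ; 1F → refl ; 2F → refl }) f0

      u∈ : InSpan (O₇ f₁ f₂ f₃ (inj₁ (x , y , z))) (graph n₁ n₂ n₃)
      u∈ = l , λ where
          0F → pt 0F
          1F → pt 1F
          2F → pt 2F
          3F → pt 3F
          4F → trans eq₁ (pt 4F)
          5F → trans eq₂ (pt 5F)
          6F → trans eq₃ (pt 6F)
          7F → trans (trans (solve 6 (λ x y z v₁ v₂ v₃ → :- (z :* v₁) :- y :* v₂ :- x :* v₃ :=
                 :- (x :* v₃ :+ y :* v₂ :+ z :* v₁)) refl x y z (eval f₁ u) (eval f₂ u) (eval f₃ u))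
                 (trans (-‿cong s≈0) (solve 0 (:- O := O) refl))) (pt 7F)
        where
        l = lookup (1# ∷ x ∷ y ∷ z ∷ [])
        pt = λ k → sym (graph-point n₁ n₂ n₃ l k)

      origin∈ : InSpan (O₇ f₁ f₂ f₃ (inj₁ origin)) (graph n₁ n₂ n₃)
      origin∈ = l , λ where
          0F → pt 0F
          1F → pt 1F
          2F → pt 2F
          3F → pt 3F
          4F → trans (f-origin f₁ f₁0) (trans (solve 2 (λ m n → O := m :* O :- n :* O) refl n₁ n₂) (pt 4F))
          5F → trans (f-origin f₂ f₂0) (trans (solve 2 (λ m n → O := m :* O :- n :* O) refl n₃ n₁) (pt 5F))
          6F → trans (f-origin f₃ f₃0) (trans (solve 2 (λ m n → O := m :* O :- n :* O) refl n₂ n₃) (pt 6F))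
          7F → trans (solve 3 (λ a b c → :- (O :* a) :- O :* b :- O :* c := O) refl _ _ _) (pt 7F)
        where
        l = lookup (1# ∷ 0# ∷ 0# ∷ 0# ∷ [])
        pt = λ k → sym (graph-point n₁ n₂ n₃ l k)

      samePoint = proj₂ (generators (graph n₁ n₂ n₃) (graph-isGenerator n₁ n₂ n₃)) (inj₁ (x , y , z)) (inj₁ origin) u∈ origin∈

      u≈0 : ∀ k → u k ≈ 0#
      u≈0 0F = trans (proj₂ samePoint 1F) (zeroʳ _)
      u≈0 1F = trans (proj₂ samePoint 2F) (zeroʳ _)
      u≈0 2F = trans (proj₂ samePoint 3F) (zeroʳ _)

-- Affine forms on pairs of vectors and zeros of their products

¬¬-Fin : ∀ {n} {P : Fin n → Set} → (∀ i → ¬ ¬ P i) → ¬ ¬ (∀ i → P i)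
¬¬-Fin {zero} ¬¬P ¬∀ = ¬∀ λ ()
¬¬-Fin {suc n} ¬¬P ¬∀ = ¬¬P zero λ p → ¬¬-Fin (¬¬P ∘ suc) λ ps → ¬∀ λ { zero → p ; (suc i) → ps i }

module LinearForms (K : Field) (stable : ∀ {x y} → ¬ ¬ (Field._≈_ K x y) → Field._≈_ K x y)
  (sample : Fin 5 → Field.Carrier K) (sample-injective : ∀ i j → Field._≈_ K (sample i) (sample j) → i ≡ j) where
  open Field K hiding (zero)
  open FieldProperties K
  open IntegerSolver commutativeRing
  open Relation.Binary.Reasoning.Setoid setoid

  private
    I O : ∀ {n} → Polynomial n
    I = con (+ 1)
    O = con (+ 0)

  V : Set
  V = Fin 3 → Carrier

  infix 8 _∙_
  infixl 6 _+ᵛ_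
  infixl 7 _*ᵛ_
  _∙_ : V → V → Carrier
  u ∙ v = u 0F * v 0F + u 1F * v 1F + u 2F * v 2F

  0ᵛ : V
  0ᵛ _ = 0#

  _+ᵛ_ : V → V → V
  (u +ᵛ v) i = u i + v i

  _*ᵛ_ : Carrier → V → V
  (s *ᵛ v) i = s * v i

  lineᵛ : Carrier → V → V → V
  lineᵛ t a b i = a i + t * (b i - a i)

  ∙-line : ∀ u t a b → u ∙ lineᵛ t a b ≈ u ∙ a + t * (u ∙ b - u ∙ a)
  ∙-line u t a b = solve 10 (λ u v w t a₀ a₁ a₂ b₀ b₁ b₂ →
    u :* (a₀ :+ t :* (b₀ :- a₀)) :+ v :* (a₁ :+ t :* (b₁ :- a₁)) :+ w :* (a₂ :+ t :* (b₂ :- a₂)) :=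
    (u :* a₀ :+ v :* a₁ :+ w :* a₂) :+ t :* ((u :* b₀ :+ v :* b₁ :+ w :* b₂) :- (u :* a₀ :+ v :* a₁ :+ w :* a₂)))
    refl (u 0F) (u 1F) (u 2F) t (a 0F) (a 1F) (a 2F) (b 0F) (b 1F) (b 2F)

  ∙-0 : ∀ u → u ∙ 0ᵛ ≈ 0#
  ∙-0 u = solve 3 (λ a b c → a :* O :+ b :* O :+ c :* O := O) refl (u 0F) (u 1F) (u 2F)

  ∙-+ : ∀ u a b → u ∙ (a +ᵛ b) ≈ u ∙ a + u ∙ b
  ∙-+ u a b = solve 9 (λ u v w a₀ a₁ a₂ b₀ b₁ b₂ →
    u :* (a₀ :+ b₀) :+ v :* (a₁ :+ b₁) :+ w :* (a₂ :+ b₂) :=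
    (u :* a₀ :+ v :* a₁ :+ w :* a₂) :+ (u :* b₀ :+ v :* b₁ :+ w :* b₂))
    refl (u 0F) (u 1F) (u 2F) (a 0F) (a 1F) (a 2F) (b 0F) (b 1F) (b 2F)

  ∙-* : ∀ u s a → u ∙ (s *ᵛ a) ≈ s * u ∙ a
  ∙-* u s a = solve 7 (λ u v w s a₀ a₁ a₂ →
    u :* (s :* a₀) :+ v :* (s :* a₁) :+ w :* (s :* a₂) := s :* (u :* a₀ :+ v :* a₁ :+ w :* a₂))
    refl (u 0F) (u 1F) (u 2F) s (a 0F) (a 1F) (a 2F)

  record Form : Set where
    constructor form
    field
      const : Carrier
      left right : V
  open Form public

  Point : Set
  Point = V × V

  line : Carrier → Point → Point → Point
  line t (a , b) (a' , b') = lineᵛ t a a' , lineᵛ t b b'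

  value : Form → Point → Carrier
  value A (a , b) = const A + (left A ∙ a + right A ∙ b)

  IsAffine : (Point → Carrier) → Set
  IsAffine f = ∀ t p r → f (line t p r) ≈ f p + t * (f r - f p)

  value-affine : ∀ A → IsAffine (value A)
  value-affine A t (a , b) (a' , b') = begin
    const A + (left A ∙ lineᵛ t a a' + right A ∙ lineᵛ t b b')
      ≈⟨ +-congˡ (+-cong (∙-line (left A) t a a') (∙-line (right A) t b b')) ⟩
    const A + ((left A ∙ a + t * (left A ∙ a' - left A ∙ a)) + (right A ∙ b + t * (right A ∙ b' - right A ∙ b)))
      ≈⟨ solve 6 (λ k t x x' y y' → k :+ ((x :+ t :* (x' :- x)) :+ (y :+ t :* (y' :- y))) :=
           (k :+ (x :+ y)) :+ t :* ((k :+ (x' :+ y')) :- (k :+ (x :+ y))))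
           refl (const A) t (left A ∙ a) (left A ∙ a') (right A ∙ b) (right A ∙ b') ⟩
    value A (a , b) + t * (value A (a' , b') - value A (a , b)) ∎

  module Subspace (H : Point → Set) (H-line : ∀ t {p r} → H p → H r → H (line t p r)) {p₀ : Point} (H-p₀ : H p₀) where

    -- Restricted to the line through two points each function has at most one zero,
    -- so among more parameters than functions one avoids all zeros.
    common-nonzero : ∀ n (f : Fin n → Point → Carrier) → (∀ j → IsAffine (f j)) →
      (t : Fin (suc n) → Carrier) → (∀ i j → t i ≈ t j → i ≡ j) →
      (∀ j → ∃ λ p → H p × ¬ f j p ≈ 0#) → ¬ ¬ (∃ λ p → H p × ∀ j → ¬ f j p ≈ 0#)
    common-nonzero zero f f-aff t t-inj nz none = none (p₀ , H-p₀ , λ ())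
    common-nonzero (suc n) f f-aff t t-inj nz none =
      common-nonzero n (f ∘ suc) (f-aff ∘ suc) (t ∘ inject₁)
        (λ i j → Fin.inject₁-injective ∘ t-inj (inject₁ i) (inject₁ j)) (nz ∘ suc) step
      where
      step : ¬ (∃ λ p → H p × ∀ j → ¬ f (suc j) p ≈ 0#)
      step (p , Hp , fp≉0) = ¬¬-Fin (λ i no → none (line (t i) p r , H-line (t i) Hp Hr , λ j z → no (j , z))) clash
        where
        r = proj₁ (nz zero)
        Hr = proj₁ (proj₂ (nz zero))

        -- A function with two zeros on the line vanishes at both ends, p at t = 0 and r at t = 1.
        -- Function 0 is nonzero at r and the others are nonzero at p.
        not-both : ∀ j → f j p ≈ 0# → f j r ≈ 0# → ⊥
        not-both zero _ fr≈0 = proj₂ (proj₂ (nz zero)) fr≈0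
        not-both (suc j) fp≈0 _ = fp≉0 j fp≈0

        clash : ¬ (∀ i → ∃ λ j → f j (line (t i) p r) ≈ 0#)
        clash z with Fin.pigeonhole (ℕ.n<1+n (suc n)) (proj₁ ∘ z)
        ... | i , i' , i<i' , ji≡ji' = not-both j P≈0 (trans (x-y≈0⇒x≈y R-P≈0) P≈0)
          where
          j = proj₁ (z i)
          P = f j p
          R = f j r

          zero-at : ∀ k → proj₁ (z k) ≡ j → P + t k * (R - P) ≈ 0#
          zero-at k jk≡j = trans (sym (f-aff j (t k) p r))
            (≡.subst (λ j → f j (line (t k) p r) ≈ 0#) jk≡j (proj₂ (z k)))

          R-P≈0 : R - P ≈ 0#
          R-P≈0 = x*y≈0⇒y≈0 {t i - t i'}
            (λ ti-ti'≈0 → Fin.<⇒≢ i<i' (t-inj i i' (x-y≈0⇒x≈y ti-ti'≈0)))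
            (trans (solve 4 (λ s s' P d → (s :- s') :* d := (P :+ s :* d) :- (P :+ s' :* d)) refl (t i) (t i') P (R - P))
              (x≈y⇒x-y≈0 (trans (zero-at i ≡.refl) (sym (zero-at i' (≡.sym ji≡ji'))))))

          P≈0 : P ≈ 0#
          P≈0 = begin
            P                      ≈⟨ +-identityʳ P ⟨
            P + 0#                 ≈⟨ +-congˡ (zeroʳ (t i)) ⟨
            P + t i * 0#           ≈⟨ +-congˡ (*-congˡ R-P≈0) ⟨
            P + t i * (R - P)      ≈⟨ zero-at i ≡.refl ⟩
            0#                     ∎

    -- This replaces primality of the ideal of a linear subspace. The four functions account for the
    -- size of `sample`: one parameter more than there are functions.
    some-factor-vanishes : (f : Fin 4 → Point → Carrier) → (∀ j → IsAffine (f j)) →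
      (∀ p → H p → f 0F p * f 1F p * f 2F p * f 3F p ≈ 0#) → ¬ ¬ (∃ λ j → ∀ p → H p → f j p ≈ 0#)
    some-factor-vanishes f f-aff prod≈0 none =
      ¬¬-Fin (λ j no → none (j , λ p Hp → stable λ fp≉0 → no (p , Hp , fp≉0))) λ nz →
      common-nonzero 4 f f-aff sample sample-injective nz λ (p , Hp , fp≉0) →
      *-nonzero (*-nonzero (*-nonzero (fp≉0 0F) (fp≉0 1F)) (fp≉0 2F)) (fp≉0 3F) (prod≈0 p Hp)

  Diagonal : Point → Set
  Diagonal (a , b) = ∀ i → a i ≈ b i

  Diagonal-line : ∀ t {p r} → Diagonal p → Diagonal r → Diagonal (line t p r)
  Diagonal-line t p∈ r∈ i = +-cong (p∈ i) (*-congˡ (+-cong (r∈ i) (-‿cong (p∈ i))))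

  Hyperplane : V → Point → Set
  Hyperplane d (a , b) = d ∙ a ≈ d ∙ b

  Hyperplane-line : ∀ d t {p r} → Hyperplane d p → Hyperplane d r → Hyperplane d (line t p r)
  Hyperplane-line d t {a , b} {a' , b'} p∈ r∈ = begin
    d ∙ lineᵛ t a a'                    ≈⟨ ∙-line d t a a' ⟩
    d ∙ a + t * (d ∙ a' - d ∙ a)        ≈⟨ +-cong p∈ (*-congˡ (+-cong r∈ (-‿cong p∈))) ⟩
    d ∙ b + t * (d ∙ b' - d ∙ b)        ≈⟨ ∙-line d t b b' ⟨
    d ∙ lineᵛ t b b'                    ∎

  Nonconstant : Form → Set
  Nonconstant A = ¬ ((∀ i → left A i ≈ 0#) × (∀ i → right A i ≈ 0#))

  Vanishes : (Point → Set) → Form → Set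
  Vanishes H A = ∀ p → H p → value A p ≈ 0#

  e : Fin 3 → V
  e 0F = lookup (1# ∷ 0# ∷ 0# ∷ [])
  e 1F = lookup (0# ∷ 1# ∷ 0# ∷ [])
  e 2F = lookup (0# ∷ 0# ∷ 1# ∷ [])

  ∙-e : ∀ u i → u ∙ e i ≈ u i
  ∙-e u 0F = solve 3 (λ a b c → a :* I :+ b :* O :+ c :* O := a) refl (u 0F) (u 1F) (u 2F)
  ∙-e u 1F = solve 3 (λ a b c → a :* O :+ b :* I :+ c :* O := b) refl (u 0F) (u 1F) (u 2F)
  ∙-e u 2F = solve 3 (λ a b c → a :* O :+ b :* O :+ c :* I := c) refl (u 0F) (u 1F) (u 2F)

  diagonal-const : ∀ {A} → Vanishes Diagonal A → const A ≈ 0#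
  diagonal-const {A} A0 = begin
    const A                                      ≈⟨ solve 1 (λ x → x := x :+ (O :+ O)) refl _ ⟩
    const A + (0# + 0#)                          ≈⟨ +-congˡ (+-cong (∙-0 (left A)) (∙-0 (right A))) ⟨
    value A (0ᵛ , 0ᵛ)                            ≈⟨ A0 (0ᵛ , 0ᵛ) (λ _ → refl) ⟩
    0#                                           ∎

  diagonal-opposite : ∀ {A} → Vanishes Diagonal A → ∀ a → left A ∙ a + right A ∙ a ≈ 0#
  diagonal-opposite {A} A0 a = begin
    left A ∙ a + right A ∙ a                     ≈⟨ +-identityˡ _ ⟨
    0# + (left A ∙ a + right A ∙ a)              ≈⟨ +-congʳ (diagonal-const {A} A0) ⟨
    value A (a , a)                              ≈⟨ A0 (a , a) (λ _ → refl) ⟩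
    0#                                           ∎

  ∙-congʳ : ∀ u {a b} → (∀ i → a i ≈ b i) → u ∙ a ≈ u ∙ b
  ∙-congʳ u a≈b = +-cong (+-cong (*-congˡ (a≈b 0F)) (*-congˡ (a≈b 1F))) (*-congˡ (a≈b 2F))

  hyperplane⇒diagonal : ∀ {d A} → Vanishes (Hyperplane d) A → Vanishes Diagonal A
  hyperplane⇒diagonal {d} A0 p p∈ = A0 p (∙-congʳ d p∈)

  -- The pair (a, 0) lies on the hyperplane exactly when d·a = 0, and there only the left part of
  -- the form remains.
  hyperplane-left : ∀ {d A} → Vanishes (Hyperplane d) A → ∀ a → d ∙ a ≈ 0# → left A ∙ a ≈ 0#
  hyperplane-left {d} {A} A0 a da≈0 = begin
    left A ∙ a                                   ≈⟨ solve 1 (λ x → x := O :+ (x :+ O)) refl _ ⟩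
    0# + (left A ∙ a + 0#)                       ≈⟨ +-cong (diagonal-const {A} (hyperplane⇒diagonal {d} {A} A0)) (+-congˡ (∙-0 (right A))) ⟨
    value A (a , 0ᵛ)                             ≈⟨ A0 (a , 0ᵛ) (trans da≈0 (sym (∙-0 d))) ⟩
    0#                                           ∎

  diagonal-right : ∀ {A} → Vanishes Diagonal A → ∀ a → right A ∙ a ≈ - (left A ∙ a)
  diagonal-right {A} A0 a = begin
    right A ∙ a                                      ≈⟨ solve 2 (λ x y → y := (x :+ y) :- x) refl (left A ∙ a) _ ⟩
    (left A ∙ a + right A ∙ a) - left A ∙ a          ≈⟨ +-congʳ (diagonal-opposite {A} A0 a) ⟩
    0# - left A ∙ a                                  ≈⟨ +-identityˡ _ ⟩
    - (left A ∙ a)                                   ∎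

  -- `G` is symmetric in a and b, so exchanging them carries statements on left parts over to right
  -- parts.
  swap : Form → Form
  swap (form k m n) = form k n m

  value-swap : ∀ A a b → value (swap A) (a , b) ≈ value A (b , a)
  value-swap A a b = +-congˡ (+-comm _ _)

  swap-vanishes : ∀ {d A} → Vanishes (Hyperplane d) A → Vanishes (Hyperplane d) (swap A)
  swap-vanishes {A = A} A0 (a , b) p∈ = trans (value-swap A a b) (A0 (b , a) (sym p∈))

  -- secondDifference E s t is the operator h ↦ h(s) − (1 − s) h(0) − s h(1), which kills
  -- affine functions, applied to E in both variables.
  secondDifference : (Carrier → Carrier → Carrier) → Carrier → Carrier → Carrier
  secondDifference E s t =
    (E s t - (1# - s) * E 0# t - s * E 1# t)
      - (1# - t) * (E s 0# - (1# - s) * E 0# 0# - s * E 1# 0#)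
      - t * (E s 1# - (1# - s) * E 0# 1# - s * E 1# 1#)

  secondDifference-cong : ∀ {E E'} → (∀ s t → E s t ≈ E' s t) → ∀ s t → secondDifference E s t ≈ secondDifference E' s t
  secondDifference-cong {E} {E'} E≈ s t =
    +-cong (+-cong (inner t) (-‿cong (*-congˡ (inner 0#)))) (-‿cong (*-congˡ (inner 1#)))
    where
    inner : ∀ t → E s t - (1# - s) * E 0# t - s * E 1# t ≈ E' s t - (1# - s) * E' 0# t - s * E' 1# t
    inner t = +-cong (+-cong (E≈ s t) (-‿cong (*-congˡ (E≈ 0# t)))) (-‿cong (*-congˡ (E≈ 1# t)))

  secondDifference-+ : ∀ E E' s t → secondDifference (λ s t → E s t + E' s t) s t ≈ secondDifference E s t + secondDifference E' s t
  secondDifference-+ E E' s t = trans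
    (+-cong (+-cong (inner t) (-‿cong (*-congˡ (inner 0#)))) (-‿cong (*-congˡ (inner 1#))))
    (solve 8 (λ s t a b c a' b' c' → (a :+ a') :- (I :- t) :* (b :+ b') :- t :* (c :+ c') :=
      (a :- (I :- t) :* b :- t :* c) :+ (a' :- (I :- t) :* b' :- t :* c')) refl s t _ _ _ _ _ _)
    where
    inner : ∀ t → (E s t + E' s t) - (1# - s) * (E 0# t + E' 0# t) - s * (E 1# t + E' 1# t) ≈
                  (E s t - (1# - s) * E 0# t - s * E 1# t) + (E' s t - (1# - s) * E' 0# t - s * E' 1# t)
    inner t = solve 7 (λ s a b c a' b' c' → (a :+ a') :- (I :- s) :* (b :+ b') :- s :* (c :+ c') :=
      (a :- (I :- s) :* b :- s :* c) :+ (a' :- (I :- s) :* b' :- s :* c')) refl s _ _ _ _ _ _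

  -- Expanding gives s·h(t), s·g(s), t·h(t) and t·g(s) up to constants. Each is affine in one of the
  -- two variables, whatever the functions `g` and `h` are.
  secondDifference-bilinear : ∀ a b (g h : Carrier → Carrier) s t →
    secondDifference (λ s t → (s * a - t * b) * (h t - g s)) s t ≈ 0#
  secondDifference-bilinear a b g h s t = solve 10 (λ s t a b ht h0 h1 gs g0 g1 →
     let G = λ s t h g → (s :* a :- t :* b) :* (h :- g) in
     (G s t ht gs :- (I :- s) :* G O t ht g0 :- s :* G I t ht g1)
      :- (I :- t) :* (G s O h0 gs :- (I :- s) :* G O O h0 g0 :- s :* G I O h0 g1)
      :- t :* (G s I h1 gs :- (I :- s) :* G O I h1 g0 :- s :* G I I h1 g1) := O)
    refl s t a b (h t) (h 0#) (h 1#) (g s) (g 0#) (g 1#)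

  -- The terms with `k` and `ε` are linear in s and disappear. The term s²t² with `δ` survives, each
  -- square x² turning into x² - x.
  secondDifference-product : ∀ α β γ k δ ε s t →
    secondDifference (λ s t → s * α * (t * β) * (t * γ) * (k + (s * δ + t * ε))) s t ≈
    α * β * γ * δ * ((s * s - s) * (t * t - t))
  secondDifference-product α β γ k δ ε s t = solve 8 (λ α β γ k δ ε s t →
     let E = λ s t → s :* α :* (t :* β) :* (t :* γ) :* (k :+ (s :* δ :+ t :* ε)) in
     (E s t :- (I :- s) :* E O t :- s :* E I t)
      :- (I :- t) :* (E s O :- (I :- s) :* E O O :- s :* E I O)
      :- t :* (E s I :- (I :- s) :* E O I :- s :* E I I) :=
     α :* β :* γ :* δ :* ((s :* s :- s) :* (t :* t :- t))) refl α β γ k δ ε s t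

  -- Factorizations of G into four affine forms

  module Factorization (g : Fin 3 → V → Carrier) where

    G : Point → Carrier
    G (a , b) = (a 0F - b 0F) * (g 0F b - g 0F a) + (a 1F - b 1F) * (g 1F b - g 1F a) + (a 2F - b 2F) * (g 2F b - g 2F a)

    G-swap : ∀ a b → G (a , b) ≈ G (b , a)
    G-swap a b = +-cong (+-cong (sym-term _ _ _ _) (sym-term _ _ _ _)) (sym-term _ _ _ _)
      where
      sym-term : ∀ a b x y → (a - b) * (x - y) ≈ (b - a) * (y - x)
      sym-term = solve 4 (λ a b x y → (a :- b) :* (x :- y) := (b :- a) :* (y :- x)) refl

    G-diagonal : ∀ p → Diagonal p → G p ≈ 0#
    G-diagonal p p∈ = trans (+-cong (+-cong (z 0F) (z 1F)) (z 2F)) (solve 0 (O :+ O :+ O := O) refl)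
      where
      z : ∀ i → (proj₁ p i - proj₂ p i) * (g i (proj₂ p) - g i (proj₁ p)) ≈ 0#
      z i = trans (*-congʳ (x≈y⇒x-y≈0 (p∈ i))) (zeroˡ _)

    secondDifference-G : ∀ a b s t → secondDifference (λ s t → G (s *ᵛ a , t *ᵛ b)) s t ≈ 0#
    secondDifference-G a b s t = begin
      secondDifference (λ s t → G (s *ᵛ a , t *ᵛ b)) s t
        ≈⟨ secondDifference-+ (λ s t → T 0F s t + T 1F s t) (T 2F) s t ⟩
      secondDifference (λ s t → T 0F s t + T 1F s t) s t + secondDifference (T 2F) s t
        ≈⟨ +-congʳ (secondDifference-+ (T 0F) (T 1F) s t) ⟩
      secondDifference (T 0F) s t + secondDifference (T 1F) s t + secondDifference (T 2F) s t
        ≈⟨ +-cong (+-cong (z 0F) (z 1F)) (z 2F) ⟩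
      0# + 0# + 0#
        ≈⟨ solve 0 (O :+ O :+ O := O) refl ⟩
      0# ∎
      where
      T : Fin 3 → Carrier → Carrier → Carrier
      T i s t = (s * a i - t * b i) * (g i (t *ᵛ b) - g i (s *ᵛ a))

      z : ∀ i → secondDifference (T i) s t ≈ 0#
      z i = secondDifference-bilinear (a i) (b i) (λ s → g i (s *ᵛ a)) (λ t → g i (t *ᵛ b)) s t

    Factors : (A B C D : Form) → Set
    Factors A B C D = ∀ p → G p ≈ value A p * value B p * value C p * value D p

    -- These transpositions bring a factor found at any position to the place where it is wanted.
    factors-21 : ∀ {A B C D} → Factors A B C D → Factors B A C D
    factors-21 G≈ p = trans (G≈ p) (solve 4 (λ a b c d → a :* b :* c :* d := b :* a :* c :* d) refl _ _ _ _)

    factors-31 : ∀ {A B C D} → Factors A B C D → Factors C B A D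
    factors-31 G≈ p = trans (G≈ p) (solve 4 (λ a b c d → a :* b :* c :* d := c :* b :* a :* d) refl _ _ _ _)

    factors-41 : ∀ {A B C D} → Factors A B C D → Factors D B C A
    factors-41 G≈ p = trans (G≈ p) (solve 4 (λ a b c d → a :* b :* c :* d := d :* b :* c :* a) refl _ _ _ _)

    factors-32 : ∀ {A B C D} → Factors A B C D → Factors A C B D
    factors-32 G≈ p = trans (G≈ p) (solve 4 (λ a b c d → a :* b :* c :* d := a :* c :* b :* d) refl _ _ _ _)

    factors-42 : ∀ {A B C D} → Factors A B C D → Factors A D C B
    factors-42 G≈ p = trans (G≈ p) (solve 4 (λ a b c d → a :* b :* c :* d := a :* d :* c :* b) refl _ _ _ _)

    factors-43 : ∀ {A B C D} → Factors A B C D → Factors A B D C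
    factors-43 G≈ p = trans (G≈ p) (solve 4 (λ a b c d → a :* b :* c :* d := a :* b :* d :* c) refl _ _ _ _)

    factors-swap : ∀ {A B C D} → Factors A B C D → Factors (swap A) (swap B) (swap C) (swap D)
    factors-swap {A} {B} {C} {D} G≈ (a , b) = trans (G-swap a b) (trans (G≈ (b , a))
      (sym (*-cong (*-cong (*-cong (value-swap A a b) (value-swap B a b)) (value-swap C a b)) (value-swap D a b))))

    -- Three distinct samples stand against the two possible roots of t² - t.
    sample-not-idempotent : ¬ (∀ i → sample i * sample i - sample i ≈ 0#)
    sample-not-idempotent idem = RootBound.monic-roots K (RootBound.monic-^-t K 0) (sample ∘ inject₁ ∘ inject₁)
      (λ i j → Fin.inject₁-injective ∘ Fin.inject₁-injective ∘ sample-injective _ _)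
      λ i → trans (solve 1 (λ x → x :* (x :* I) :- x := x :* x :- x) refl _) (idem _)

    -- With δ = left D · a, second differences along (s·a, t·b) give αβγδ(s² - s)(t² - t) = 0.
    -- Setting s = t to a sample with s² ≠ s forces δ = 0.
    product-coefficient : ∀ {A B C D} → Factors A B C D → ∀ a b {α β γ} → ¬ α ≈ 0# → ¬ β ≈ 0# → ¬ γ ≈ 0# →
      (∀ s t → value A (s *ᵛ a , t *ᵛ b) ≈ s * α) → (∀ s t → value B (s *ᵛ a , t *ᵛ b) ≈ t * β) →
      (∀ s t → value C (s *ᵛ a , t *ᵛ b) ≈ t * γ) → left D ∙ a ≈ 0#
    product-coefficient {D = D} G≈ a b {α} {β} {γ} α≉0 β≉0 γ≉0 A≈ B≈ C≈ =
      stable λ δ≉0 → sample-not-idempotent λ i → stable λ sᵢ≉0 →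
        *-nonzero (*-nonzero (*-nonzero (*-nonzero α≉0 β≉0) γ≉0) δ≉0) (*-nonzero sᵢ≉0 sᵢ≉0) (begin
          α * β * γ * (left D ∙ a) * _           ≈⟨ secondDifference-product α β γ (const D) (left D ∙ a) (right D ∙ b) (sample i) (sample i) ⟨
          secondDifference (λ s t → s * α * (t * β) * (t * γ) * (const D + (s * left D ∙ a + t * right D ∙ b))) (sample i) (sample i)
            ≈⟨ secondDifference-cong (λ s t → trans (G≈ (s *ᵛ a , t *ᵛ b))
                 (*-cong (*-cong (*-cong (A≈ s t) (B≈ s t)) (C≈ s t)) (+-congˡ (+-cong (∙-* (left D) s a) (∙-* (right D) t b)))))
                 (sample i) (sample i) ⟨
          secondDifference (λ s t → G (s *ᵛ a , t *ᵛ b)) (sample i) (sample i) ≈⟨ secondDifference-G a b (sample i) (sample i) ⟩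
          0# ∎)

    -- Up to the factor `Δ`, `w` is the basis dual to `d`; keeping the factor lets cofactor vectors
    -- serve as `w`.
    module Basis (d w : Fin 3 → V) {Δ : Carrier} (Δ≉0 : ¬ Δ ≈ 0#)
      (dw≈0 : ∀ i j → i ≢ j → d i ∙ w j ≈ 0#)
      (expansion : ∀ a k → Δ * a k ≈ d 0F ∙ a * w 0F k + d 1F ∙ a * w 1F k + d 2F ∙ a * w 2F k) where

      On : Fin 3 → Form → Set
      On i = Vanishes (Hyperplane (d i))

      zero-on-basis : ∀ u → (∀ i → u ∙ w i ≈ 0#) → ∀ k → u k ≈ 0#
      zero-on-basis u uw≈0 k = x*y≈0⇒y≈0 Δ≉0 (begin
        Δ * u k                      ≈⟨ *-congˡ (∙-e u k) ⟨
        Δ * u ∙ e k                  ≈⟨ ∙-* u Δ (e k) ⟨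
        u ∙ (Δ *ᵛ e k)               ≈⟨ ∙-congʳ u (expansion (e k)) ⟩
        u ∙ ((x 0F *ᵛ w 0F +ᵛ x 1F *ᵛ w 1F) +ᵛ x 2F *ᵛ w 2F)
          ≈⟨ trans (∙-+ u (x 0F *ᵛ w 0F +ᵛ x 1F *ᵛ w 1F) (x 2F *ᵛ w 2F))
               (+-cong (trans (∙-+ u (x 0F *ᵛ w 0F) (x 1F *ᵛ w 1F)) (+-cong (term 0F) (term 1F))) (term 2F)) ⟩
        0# + 0# + 0#                 ≈⟨ solve 0 (O :+ O :+ O := O) refl ⟩
        0#                           ∎)
        where
        x = λ i → d i ∙ e k
        term : ∀ i → u ∙ (x i *ᵛ w i) ≈ 0#
        term i = trans (∙-* u (x i) (w i)) (trans (*-congˡ (uw≈0 i)) (zeroʳ _))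

      on-left≈0 : ∀ i {A j} → On i A → i ≢ j → left A ∙ w j ≈ 0#
      on-left≈0 i {A} A0 i≢j = hyperplane-left {d i} {A} A0 (w _) (dw≈0 i _ i≢j)

      on-right : ∀ i {A} → On i A → ∀ a → right A ∙ a ≈ - (left A ∙ a)
      on-right i {A} A0 = diagonal-right {A} (hyperplane⇒diagonal {d i} {A} A0)

      -- The left part kills the `w j` with j ≠ i, which lie in the kernel of `d i`. If it killed
      -- `w i` too, it would be zero, and so would the right part, its negative.
      on-left≉0 : ∀ i {A} → On i A → Nonconstant A → ¬ left A ∙ w i ≈ 0#
      on-left≉0 i {A} A0 A-nc Awᵢ≈0 = A-nc (zero-on-basis (left A) left≈0 , zero-on-basis (right A) λ j →
          trans (on-right i {A} A0 (w j)) (trans (-‿cong (left≈0 j)) (solve 0 (:- O := O) refl)))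
        where
        left≈0 : ∀ j → left A ∙ w j ≈ 0#
        left≈0 j with i Fin.≟ j
        ... | yes ≡.refl = Awᵢ≈0
        ... | no i≢j = on-left≈0 i {A} A0 i≢j

      on-unique : ∀ {i j A} → i ≢ j → Nonconstant A → On i A → ¬ On j A
      on-unique {i} {j} {A} i≢j A-nc Aᵢ Aⱼ = on-left≉0 i {A} Aᵢ A-nc (on-left≈0 j {A} Aⱼ (i≢j ∘ ≡.sym))

      on-value : ∀ i {A} → On i A → ∀ s t a b → value A (s *ᵛ a , t *ᵛ b) ≈ s * left A ∙ a - t * left A ∙ b
      on-value i {A} A0 s t a b = begin
        const A + (left A ∙ (s *ᵛ a) + right A ∙ (t *ᵛ b))
          ≈⟨ +-cong (diagonal-const {A} (hyperplane⇒diagonal {d i} {A} A0))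
               (+-cong (∙-* (left A) s a) (trans (∙-* (right A) t b) (*-congˡ (on-right i {A} A0 b)))) ⟩
        0# + (s * left A ∙ a + t * - (left A ∙ b))
          ≈⟨ solve 4 (λ s t x y → O :+ (s :* x :+ t :* (:- y)) := s :* x :- t :* y) refl s t (left A ∙ a) (left A ∙ b) ⟩
        s * left A ∙ a - t * left A ∙ b ∎

      -- At a = `w i` and b = `w j +ᵛ w k` the form `A` sees only a, while `B` and `C` see only b,
      -- each through its own basis vector, where it is nonzero.
      remaining-left≈0 : ∀ i j k {A B C D} → i ≢ j → i ≢ k → j ≢ k →
        On i A → On j B → On k C → Nonconstant A → Nonconstant B → Nonconstant C →
        Factors A B C D → left D ∙ w i ≈ 0#
      remaining-left≈0 i j k {A} {B} {C} {D} i≢j i≢k j≢k Aᵢ Bⱼ Cₖ A-nc B-nc C-nc G≈ =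
        product-coefficient {A} {B} {C} {D} G≈ (w i) (w j +ᵛ w k)
          (on-left≉0 i {A} Aᵢ A-nc) (neg≉0 (on-left≉0 j {B} Bⱼ B-nc)) (neg≉0 (on-left≉0 k {C} Cₖ C-nc))
          (λ s t → trans (on-value i {A} Aᵢ s t (w i) (w j +ᵛ w k))
            (trans (+-congˡ (-‿cong (*-congˡ (trans (∙-+ (left A) (w j) (w k))
              (+-cong (on-left≈0 i {A} Aᵢ i≢j) (on-left≈0 i {A} Aᵢ i≢k))))))
              (solve 3 (λ s t x → s :* x :- t :* (O :+ O) := s :* x) refl s t _)))
          (λ s t → trans (on-value j {B} Bⱼ s t (w i) (w j +ᵛ w k))
            (trans (+-cong (*-congˡ (on-left≈0 j {B} Bⱼ (i≢j ∘ ≡.sym)))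
              (-‿cong (*-congˡ (trans (∙-+ (left B) (w j) (w k)) (+-congˡ (on-left≈0 j {B} Bⱼ j≢k))))))
              (solve 3 (λ s t x → s :* O :- t :* (x :+ O) := t :* (:- x)) refl s t _)))
          (λ s t → trans (on-value k {C} Cₖ s t (w i) (w j +ᵛ w k))
            (trans (+-cong (*-congˡ (on-left≈0 k {C} Cₖ (i≢k ∘ ≡.sym)))
              (-‿cong (*-congˡ (trans (∙-+ (left C) (w j) (w k)) (+-congʳ (on-left≈0 k {C} Cₖ (j≢k ∘ ≡.sym)))))))
              (solve 3 (λ s t x → s :* O :- t :* (O :+ x) := t :* (:- x)) refl s t _)))
        where
        neg≉0 : ∀ {x} → ¬ x ≈ 0# → ¬ - x ≈ 0#
        neg≉0 x≉0 -x≈0 = x≉0 (trans (solve 1 (λ x → x := :- (:- x)) refl _) (trans (-‿cong -x≈0) (solve 0 (:- O := O) refl)))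

      remaining-left-zero : ∀ {A B C D} → On 0F A → On 1F B → On 2F C →
        Nonconstant A → Nonconstant B → Nonconstant C → Factors A B C D → ∀ k → left D k ≈ 0#
      remaining-left-zero {A} {B} {C} {D} A₀ B₁ C₂ A-nc B-nc C-nc G≈ = zero-on-basis (left D) λ where
        0F → remaining-left≈0 0F 1F 2F {A} {B} {C} {D} (λ ()) (λ ()) (λ ()) A₀ B₁ C₂ A-nc B-nc C-nc G≈
        1F → remaining-left≈0 1F 0F 2F {B} {A} {C} {D} (λ ()) (λ ()) (λ ()) B₁ A₀ C₂ B-nc A-nc C-nc
               (factors-21 {A} {B} {C} {D} G≈)
        2F → remaining-left≈0 2F 1F 0F {C} {B} {A} {D} (λ ()) (λ ()) (λ ()) C₂ B₁ A₀ C-nc B-nc A-nc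
               (factors-31 {A} {B} {C} {D} G≈)

      vanishing-factor : ∀ i {A B C D} → (∀ p → Hyperplane (d i) p → G p ≈ 0#) → Factors A B C D →
        ¬ ¬ (On i A ⊎ On i B ⊎ On i C ⊎ On i D)
      vanishing-factor i {A} {B} {C} {D} G0 G≈ none =
        Subspace.some-factor-vanishes (Hyperplane (d i)) (λ t {p} {r} → Hyperplane-line (d i) t {p} {r}) {0ᵛ , 0ᵛ} refl
          (λ j → value (F j)) (λ j → value-affine (F j)) (λ p p∈ → trans (sym (G≈ p)) (G0 p p∈)) λ where
            (0F , v) → none (inj₁ v)
            (1F , v) → none (inj₂ (inj₁ v))
            (2F , v) → none (inj₂ (inj₂ (inj₁ v)))
            (3F , v) → none (inj₂ (inj₂ (inj₂ v)))
        where
        F : Fin 4 → Form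
        F = lookup (A ∷ B ∷ C ∷ D ∷ [])

      -- Three factors are the given hyperplanes; then the (2,2)-part of G, which is zero,
      -- forces the fourth factor to be constant.
      no-factorization : ∀ {A B C D} → (∀ i p → Hyperplane (d i) p → G p ≈ 0#) →
        Nonconstant A → Nonconstant B → Nonconstant C → Nonconstant D → ¬ Factors A B C D
      no-factorization {A} {B} {C} {D} G0 A-nc B-nc C-nc D-nc G≈ = vanishing-factor 0F {A} {B} {C} {D} (G0 0F) G≈ λ where
          (inj₁ v) → step₁ {A} {B} {C} {D} A-nc B-nc C-nc D-nc v G≈
          (inj₂ (inj₁ v)) → step₁ {B} {A} {C} {D} B-nc A-nc C-nc D-nc v (factors-21 {A} {B} {C} {D} G≈)
          (inj₂ (inj₂ (inj₁ v))) → step₁ {C} {B} {A} {D} C-nc B-nc A-nc D-nc v (factors-31 {A} {B} {C} {D} G≈)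
          (inj₂ (inj₂ (inj₂ v))) → step₁ {D} {B} {C} {A} D-nc B-nc C-nc A-nc v (factors-41 {A} {B} {C} {D} G≈)
        where
        step₃ : ∀ {A B C D} → Nonconstant A → Nonconstant B → Nonconstant C → Nonconstant D →
                On 0F A → On 1F B → On 2F C → ¬ Factors A B C D
        step₃ {A} {B} {C} {D} A-nc B-nc C-nc D-nc A₀ B₁ C₂ G≈ = D-nc
          ( remaining-left-zero {A} {B} {C} {D} A₀ B₁ C₂ A-nc B-nc C-nc G≈
          , remaining-left-zero {swap A} {swap B} {swap C} {swap D}
              (swap-vanishes {d 0F} {A} A₀) (swap-vanishes {d 1F} {B} B₁) (swap-vanishes {d 2F} {C} C₂)
              (λ (l , r) → A-nc (r , l)) (λ (l , r) → B-nc (r , l)) (λ (l , r) → C-nc (r , l))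
              (factors-swap {A} {B} {C} {D} G≈))

        step₂ : ∀ {A B C D} → Nonconstant A → Nonconstant B → Nonconstant C → Nonconstant D →
                On 0F A → On 1F B → ¬ Factors A B C D
        step₂ {A} {B} {C} {D} A-nc B-nc C-nc D-nc A₀ B₁ G≈ = vanishing-factor 2F {A} {B} {C} {D} (G0 2F) G≈ λ where
          (inj₁ v) → on-unique {0F} {2F} {A} (λ ()) A-nc A₀ v
          (inj₂ (inj₁ v)) → on-unique {1F} {2F} {B} (λ ()) B-nc B₁ v
          (inj₂ (inj₂ (inj₁ v))) → step₃ {A} {B} {C} {D} A-nc B-nc C-nc D-nc A₀ B₁ v G≈
          (inj₂ (inj₂ (inj₂ v))) → step₃ {A} {B} {D} {C} A-nc B-nc D-nc C-nc A₀ B₁ v (factors-43 {A} {B} {C} {D} G≈)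

        step₁ : ∀ {A B C D} → Nonconstant A → Nonconstant B → Nonconstant C → Nonconstant D →
                On 0F A → ¬ Factors A B C D
        step₁ {A} {B} {C} {D} A-nc B-nc C-nc D-nc A₀ G≈ = vanishing-factor 1F {A} {B} {C} {D} (G0 1F) G≈ λ where
          (inj₁ v) → on-unique {0F} {1F} {A} (λ ()) A-nc A₀ v
          (inj₂ (inj₁ v)) → step₂ {A} {B} {C} {D} A-nc B-nc C-nc D-nc A₀ v G≈
          (inj₂ (inj₂ (inj₁ v))) → step₂ {A} {C} {B} {D} A-nc C-nc B-nc D-nc A₀ v (factors-32 {A} {B} {C} {D} G≈)
          (inj₂ (inj₂ (inj₂ v))) → step₂ {A} {D} {C} {B} A-nc D-nc C-nc B-nc A₀ v (factors-42 {A} {B} {C} {D} G≈)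

-- Doubly negated equality on a field

module Stabilise (K : Field) where
  open Field K hiding (zero)

  private
    infix 4 _≈′_
    _≈′_ : Carrier → Carrier → Set
    x ≈′ y = ¬ ¬ (x ≈ y)

    ¬¬-map : ∀ {x y u v} → (x ≈ y → u ≈ v) → x ≈′ y → u ≈′ v
    ¬¬-map f ¬¬p ¬q = ¬¬p (¬q ∘ f)

    ¬¬-map₂ : ∀ {x y u v s t} → (x ≈ y → u ≈ v → s ≈ t) → x ≈′ y → u ≈′ v → s ≈′ t
    ¬¬-map₂ f ¬¬p ¬¬q ¬r = ¬¬p λ p → ¬¬q λ q → ¬r (f p q)

    η : ∀ {x y} → x ≈ y → x ≈′ y
    η p ¬p = ¬p p

  -- Equations and implications between them survive double negation. Being nonzero means the same
  -- for both equalities, so `1≉0` and the inverses carry over.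
  stabilise : Field
  stabilise = record
    { commutativeRing = record
      { Carrier = Carrier ; _≈_ = _≈′_ ; _+_ = _+_ ; _*_ = _*_ ; -_ = -_ ; 0# = 0# ; 1# = 1#
      ; isCommutativeRing = record
        { isRing = record
          { +-isAbelianGroup = record
            { isGroup = record
              { isMonoid = record
                { isSemigroup = record
                  { isMagma = record
                    { isEquivalence = record { refl = η refl ; sym = ¬¬-map sym ; trans = ¬¬-map₂ trans }
                    ; ∙-cong = ¬¬-map₂ +-cong }
                  ; assoc = λ x y z → η (+-assoc x y z) }
                ; identity = (λ x → η (+-identityˡ x)) , (λ x → η (+-identityʳ x)) }
              ; inverse = (λ x → η (-‿inverseˡ x)) , (λ x → η (-‿inverseʳ x))
              ; ⁻¹-cong = ¬¬-map -‿cong }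
            ; comm = λ x y → η (+-comm x y) }
          ; *-cong = ¬¬-map₂ *-cong
          ; *-assoc = λ x y z → η (*-assoc x y z)
          ; *-identity = (λ x → η (*-identityˡ x)) , (λ x → η (*-identityʳ x))
          ; distrib = (λ x y z → η (distribˡ x y z)) , (λ x y z → η (distribʳ x y z)) }
        ; *-comm = λ x y → η (*-comm x y) } }
    ; 1≉0 = λ ¬¬1≈0 → ¬¬1≈0 1≉0
    ; inverse = λ x x≉′0 → let y , xy≈1 = inverse x (x≉′0 ∘ η) in y , η xy≈1 }

  stabilise-hom : ∀ {F φ} → IsFieldHom F K φ → IsFieldHom F stabilise φ
  stabilise-hom hom = record
    { isSemiringHomomorphism = record
      { isNearSemiringHomomorphism = record
        { +-isMonoidHomomorphism = record
          { isMagmaHomomorphism = record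
            { isRelHomomorphism = record { cong = λ p → η (⟦⟧-cong p) } ; homo = λ x y → η (+-homo x y) }
          ; ε-homo = η 0#-homo }
        ; *-homo = λ x y → η (*-homo x y) }
      ; 1#-homo = η 1#-homo }
    ; -‿homo = λ x → η (-‿homo x) }
    where open RingMorphisms.IsRingHomomorphism hom

-- Cofactors and the Moore determinant in dimension three

module CrossProduct (K : Field) where
  open Field K hiding (zero)
  open IntegerSolver commutativeRing
  open Relation.Binary.Reasoning.Setoid setoid

  _⨯_ : (Fin 3 → Carrier) → (Fin 3 → Carrier) → Fin 3 → Carrier
  (u ⨯ v) 0F = u 1F * v 2F - u 2F * v 1F
  (u ⨯ v) 1F = u 2F * v 0F - u 0F * v 2F
  (u ⨯ v) 2F = u 0F * v 1F - u 1F * v 0F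

  -- The cofactor vectors of the matrix with rows `d`.
  dual : (Fin 3 → Fin 3 → Carrier) → Fin 3 → Fin 3 → Carrier
  dual d 0F = d 1F ⨯ d 2F
  dual d 1F = d 2F ⨯ d 0F
  dual d 2F = d 0F ⨯ d 1F

  _∙_ : (Fin 3 → Carrier) → (Fin 3 → Carrier) → Carrier
  u ∙ v = u 0F * v 0F + u 1F * v 1F + u 2F * v 2F

  private
    ⨯-perpˡ : ∀ u v → u ∙ (u ⨯ v) ≈ 0#
    ⨯-perpˡ u v = solve 6 (λ a b c x y z → a :* (b :* z :- c :* y) :+ b :* (c :* x :- a :* z) :+ c :* (a :* y :- b :* x) := con (+ 0))
      refl (u 0F) (u 1F) (u 2F) (v 0F) (v 1F) (v 2F)

    ⨯-perpʳ : ∀ u v → v ∙ (u ⨯ v) ≈ 0#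
    ⨯-perpʳ u v = solve 6 (λ a b c x y z → x :* (b :* z :- c :* y) :+ y :* (c :* x :- a :* z) :+ z :* (a :* y :- b :* x) := con (+ 0))
      refl (u 0F) (u 1F) (u 2F) (v 0F) (v 1F) (v 2F)

  dual-off : ∀ d i j → i ≢ j → d i ∙ dual d j ≈ 0#
  dual-off d 0F 0F i≢j = contradiction ≡.refl i≢j
  dual-off d 0F 1F _ = ⨯-perpʳ (d 2F) (d 0F)
  dual-off d 0F 2F _ = ⨯-perpˡ (d 0F) (d 1F)
  dual-off d 1F 0F _ = ⨯-perpˡ (d 1F) (d 2F)
  dual-off d 1F 1F i≢j = contradiction ≡.refl i≢j
  dual-off d 1F 2F _ = ⨯-perpʳ (d 0F) (d 1F)
  dual-off d 2F 0F _ = ⨯-perpʳ (d 1F) (d 2F)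
  dual-off d 2F 1F _ = ⨯-perpˡ (d 2F) (d 0F)
  dual-off d 2F 2F i≢j = contradiction ≡.refl i≢j

  det : (Fin 3 → Fin 3 → Carrier) → Carrier
  det d = d 0F ∙ dual d 0F

  -- Cramer's rule with the determinant left undivided.
  dual-expansion : ∀ d a k → det d * a k ≈ d 0F ∙ a * dual d 0F k + d 1F ∙ a * dual d 1F k + d 2F ∙ a * dual d 2F k
  dual-expansion d a = λ where
      0F → solve 12 (λ p q r s t u v w x a b c →
        (p :* (t :* x :- u :* w) :+ q :* (u :* v :- s :* x) :+ r :* (s :* w :- t :* v)) :* a :=
        (p :* a :+ q :* b :+ r :* c) :* (t :* x :- u :* w) :+ (s :* a :+ t :* b :+ u :* c) :* (w :* r :- x :* q)
          :+ (v :* a :+ w :* b :+ x :* c) :* (q :* u :- r :* t))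
        refl (d 0F 0F) (d 0F 1F) (d 0F 2F) (d 1F 0F) (d 1F 1F) (d 1F 2F) (d 2F 0F) (d 2F 1F) (d 2F 2F) (a 0F) (a 1F) (a 2F)
      1F → solve 12 (λ p q r s t u v w x a b c →
        (p :* (t :* x :- u :* w) :+ q :* (u :* v :- s :* x) :+ r :* (s :* w :- t :* v)) :* b :=
        (p :* a :+ q :* b :+ r :* c) :* (u :* v :- s :* x) :+ (s :* a :+ t :* b :+ u :* c) :* (x :* p :- v :* r)
          :+ (v :* a :+ w :* b :+ x :* c) :* (r :* s :- p :* u))
        refl (d 0F 0F) (d 0F 1F) (d 0F 2F) (d 1F 0F) (d 1F 1F) (d 1F 2F) (d 2F 0F) (d 2F 1F) (d 2F 2F) (a 0F) (a 1F) (a 2F)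
      2F → solve 12 (λ p q r s t u v w x a b c →
        (p :* (t :* x :- u :* w) :+ q :* (u :* v :- s :* x) :+ r :* (s :* w :- t :* v)) :* c :=
        (p :* a :+ q :* b :+ r :* c) :* (s :* w :- t :* v) :+ (s :* a :+ t :* b :+ u :* c) :* (v :* q :- w :* p)
          :+ (v :* a :+ w :* b :+ x :* c) :* (p :* t :- q :* s))
        refl (d 0F 0F) (d 0F 1F) (d 0F 2F) (d 1F 0F) (d 1F 1F) (d 1F 2F) (d 2F 0F) (d 2F 1F) (d 2F 2F) (a 0F) (a 1F) (a 2F)

  module _ {σ : Carrier → Carrier} (σ-hom : IsFieldHom K K σ) (Fixed : Carrier → Set)
    (σ-fixed : ∀ {z} → σ z ≈ z → ¬ ¬ Fixed z) where
    open FieldProperties K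
    open Homomorphism K K σ-hom

    conjugates : (Fin 3 → Carrier) → Fin 3 → Fin 3 → Carrier
    conjugates c 0F = c
    conjugates c 1F = σ ∘ c
    conjugates c 2F = σ ∘ σ ∘ c

    -- For c = (1, x, y) the determinant is X σ(Y) − Y σ(X) with X = σ x − x and Y = σ y − y.
    -- If it is zero, then X = 0 and x is fixed, or z = Y / X and y − z x are fixed.
    moore : ∀ c → c 0F ≈ 1# → (∀ α → Fixed α → ¬ c 1F ≈ α) →
      (∀ ζ β → Fixed ζ → Fixed β → ¬ c 2F ≈ ζ * c 1F + β) → ¬ det (conjugates c) ≈ 0#
    moore c c₀≈1 x-free y-free det≈0 = σ-fixed z-fixed λ z∈ → σ-fixed r-fixed λ r∈ →
        y-free z r z∈ r∈ (solve 3 (λ x y z → y := z :* x :+ (y :- z :* x)) refl x y z)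
      where
      x = c 1F
      y = c 2F
      X = σ x - x
      Y = σ y - y

      X≉0 : ¬ X ≈ 0#
      X≉0 X≈0 = σ-fixed (x-y≈0⇒x≈y X≈0) λ x∈ → x-free x x∈ refl

      σ-sub : ∀ u v → σ (u - v) ≈ σ u - σ v
      σ-sub u v = trans (+-homo _ _) (+-congˡ (-‿homo v))

      σc₀≈1 = trans (⟦⟧-cong c₀≈1) 1#-homo
      σσc₀≈1 = trans (⟦⟧-cong σc₀≈1) 1#-homo

      minor≈0 : X * σ Y - Y * σ X ≈ 0#
      minor≈0 = begin
        X * σ Y - Y * σ X
          ≈⟨ +-cong (*-congˡ (σ-sub (σ y) y)) (-‿cong (*-congˡ (σ-sub (σ x) x))) ⟩
        X * (σ (σ y) - σ y) - Y * (σ (σ x) - σ x)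
          ≈⟨ solve 6 (λ x y x' y' x'' y'' → (x' :- x) :* (y'' :- y') :- (y' :- y) :* (x'' :- x') :=
               con (+ 1) :* (x' :* y'' :- y' :* x'') :+ x :* (y' :* con (+ 1) :- con (+ 1) :* y'') :+ y :* (con (+ 1) :* x'' :- x' :* con (+ 1)))
               refl x y (σ x) (σ y) (σ (σ x)) (σ (σ y)) ⟩
        1# * (σ x * σ (σ y) - σ y * σ (σ x)) + x * (σ y * 1# - 1# * σ (σ y)) + y * (1# * σ (σ x) - σ x * 1#)
          ≈⟨ +-cong (+-cong (*-congʳ c₀≈1) (*-congˡ (+-cong (*-congˡ σσc₀≈1) (-‿cong (*-congʳ σc₀≈1)))))
               (*-congˡ (+-cong (*-congʳ σc₀≈1) (-‿cong (*-congˡ σσc₀≈1)))) ⟨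
        det (conjugates c) ≈⟨ det≈0 ⟩
        0# ∎

      X⁻¹ = proj₁ (inverse X X≉0)
      z = Y * X⁻¹

      zX≈Y : z * X ≈ Y
      zX≈Y = begin
        Y * X⁻¹ * X      ≈⟨ solve 3 (λ a b c → a :* b :* c := a :* (c :* b)) refl Y X⁻¹ X ⟩
        Y * (X * X⁻¹)    ≈⟨ *-congˡ (proj₂ (inverse X X≉0)) ⟩
        Y * 1#           ≈⟨ *-identityʳ Y ⟩
        Y                ∎

      -- Applying σ to z·X = Y gives σ z · σ X = σ Y, so X · σ X · (σ z - z) is the minor that
      -- vanishes.
      z-fixed : σ z ≈ z
      z-fixed = x-y≈0⇒x≈y (x*y≈0⇒y≈0 (*-nonzero X≉0 λ σX≈0 → injective₀ σX≈0 X≉0) (begin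
        X * σ X * (σ z - z)              ≈⟨ solve 4 (λ a b c d → a :* b :* (c :- d) := a :* (c :* b) :- d :* a :* b) refl X (σ X) (σ z) z ⟩
        X * (σ z * σ X) - z * X * σ X    ≈⟨ +-cong (*-congˡ (trans (sym (*-homo z X)) (⟦⟧-cong zX≈Y))) (-‿cong (*-congʳ zX≈Y)) ⟩
        X * σ Y - Y * σ X                ≈⟨ minor≈0 ⟩
        0#                               ∎))

      r = y - z * x

      r-fixed : σ r ≈ r
      r-fixed = x-y≈0⇒x≈y (begin
        σ (y - z * x) - (y - z * x)      ≈⟨ +-congʳ (trans (σ-sub y (z * x)) (+-congˡ (-‿cong (trans (*-homo z x) (*-congʳ z-fixed))))) ⟩
        σ y - z * σ x - (y - z * x)      ≈⟨ solve 5 (λ y' z x' y x → y' :- z :* x' :- (y :- z :* x) := (y' :- y) :- z :* (x' :- x)) refl (σ y) z (σ x) y x ⟩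
        Y - z * X                        ≈⟨ x≈y⇒x-y≈0 (sym zX≈Y) ⟩
        0#                               ∎)

-- Conjugate splittings and the contradiction with an ovoid

module Core {q p k : ℕ} (p-prime : Prime p) (q≡p^k : q ≡ p ℕ.^ k) (5≤q : 5 ≤ q)
  (Fq : Field) (size : HasSize Fq q) (f₁ f₂ f₃ : Expr (Field.Carrier Fq) 3)
  (f₁0 : Field._≈_ Fq (Poly.eval Fq f₁ (λ _ → Field.0# Fq)) (Field.0# Fq))
  (f₂0 : Field._≈_ Fq (Poly.eval Fq f₂ (λ _ → Field.0# Fq)) (Field.0# Fq))
  (f₃0 : Field._≈_ Fq (Poly.eval Fq f₃ (λ _ → Field.0# Fq)) (Field.0# Fq))
  (K : Field) (stable : ∀ {x y} → ¬ ¬ (Field._≈_ K x y) → Field._≈_ K x y)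
  {φ : Field.Carrier Fq → Field.Carrier K} (φ-hom : IsFieldHom Fq K φ) where

  private
    module Fq = Field Fq
    module PF = Poly Fq
    module FF = FiniteField Fq size
    module φ = Homomorphism Fq K φ-hom
  open Field K hiding (zero)
  open Poly K
  open FieldProperties K
  open IntegerSolver commutativeRing
  open CrossProduct K using (dual; dual-off; dual-expansion; det; conjugates; moore)
  open Algebra.Properties.Semiring.Exp semiring using (_^_; ^-congˡ)
  open Relation.Binary.Reasoning.Setoid setoid
  open LinearForms K stable (λ i → φ (FF.element (inject≤ i 5≤q)))
    (λ i j eq → Fin.inject≤-injective 5≤q 5≤q i j (FF.element-injective _ _ (FF.φ-injective {K} φ-hom eq)))

  private
    I O : ∀ {n} → Polynomial n
    I = con (+ 1)
    O = con (+ 0)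

    0<q : 0 < q
    0<q = ℕ.≤-trans (s≤s z≤n) 5≤q

    σ : Carrier → Carrier
    σ = _^ q

    -- The relation p·1 = 0 is carried from 𝔽_q to `K` by `φ`.
    σ-hom : IsFieldHom K K σ
    σ-hom = FreshmansDream.frobenius K p-prime
      (trans (sym (FF.φ-· {K} φ-hom p)) (trans (φ.⟦⟧-cong (FF.characteristic k q≡p^k)) φ.0#-homo)) k q≡p^k 0<q

    σ-φ : ∀ x → σ (φ x) ≈ φ x
    σ-φ x = trans (sym (FF.φ-^ {K} φ-hom x q)) (φ.⟦⟧-cong (FF.fermat 0<q x))

    σ-fixed : ∀ {z} → σ z ≈ z → ¬ ¬ (∃ λ a → φ a ≈ z)
    σ-fixed = FF.fixed⇒image {K} φ-hom (ℕ.≤-trans (s≤s (s≤s z≤n)) 5≤q)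

    Gq = Construction.Gpoly Fq f₁ f₂ f₃

    g : Fin 3 → V → Carrier
    g 0F = eval (mapExpr φ f₃)
    g 1F = eval (mapExpr φ f₂)
    g 2F = eval (mapExpr φ f₁)

  open Factorization g

  toForm : (Fin 7 → Carrier) → Form
  toForm c = form (c 0F) (λ i → c (suc (i Fin.↑ˡ 3))) (λ i → c (suc (3 Fin.↑ʳ i)))

  coordinates : Point → Fin 6 → Carrier
  coordinates (a , b) = lookup (a 0F ∷ a 1F ∷ a 2F ∷ b 0F ∷ b 1F ∷ b 2F ∷ [])

  eval-linForm : ∀ c p → eval (linForm c) (Coefficients.cons1 K (coordinates p)) ≈ value (toForm c) p
  eval-linForm c (a , b) = solve 13 (λ k x y z u v w a b c d e f →
    k :* I :+ (x :* a :+ (y :* b :+ (z :* c :+ (u :* d :+ (v :* e :+ (w :* f :+ O)))))) :=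
    k :+ ((x :* a :+ y :* b :+ z :* c) :+ (u :* d :+ v :* e :+ w :* f)))
    refl (c 0F) (c 1F) (c 2F) (c 3F) (c 4F) (c 5F) (c 6F) (a 0F) (a 1F) (a 2F) (b 0F) (b 1F) (b 2F)

  eval-Gpoly : ∀ p → eval (mapExpr φ Gq) (coordinates p) ≈ G p
  eval-Gpoly (a , b) =
    +-cong (+-cong (*-congˡ (+-cong (at-b f₃) (-‿cong (at-a f₃)))) (*-congˡ (+-cong (at-b f₂) (-‿cong (at-a f₂)))))
      (*-congˡ (+-cong (at-b f₁) (-‿cong (at-a f₁))))
    where
    open Construction Fq using (at; X)
    at-a : ∀ f → eval (mapExpr φ (at f (X 0F) (X 1F) (X 2F))) (coordinates (a , b)) ≈ eval (mapExpr φ f) a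
    at-a f = Evaluation.eval-map-sub K φ f _ _ λ { 0F → refl ; 1F → refl ; 2F → refl }
    at-b : ∀ f → eval (mapExpr φ (at f (X 3F) (X 4F) (X 5F))) (coordinates (a , b)) ≈ eval (mapExpr φ f) b
    at-b f = Evaluation.eval-map-sub K φ f _ _ λ { 0F → refl ; 1F → refl ; 2F → refl }

  product : (Fin 4 → Fin 7 → Carrier) → Expr Carrier 7
  product ℓ = linForm (ℓ 0F) ⊗ linForm (ℓ 1F) ⊗ linForm (ℓ 2F) ⊗ linForm (ℓ 3F)

  module _ {d : ℕ} (G-degree : PF.HasDegree Gq d) (ℓ : Fin 4 → Fin 7 → Carrier)
    (splitting : ∀ β → φ (PF.homCoeff Gq d β) ≈ coeff (product ℓ) β) where

    -- A homomorphism `ψ` that fixes the image of 𝔽_q fixes the coefficients of G, so it turns the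
    -- splitting into another splitting of the same G. The identity gives the original one, σ and σ²
    -- its conjugates.
    factors : ∀ {ψ} → IsFieldHom K K ψ → (∀ x → ψ (φ x) ≈ φ x) →
      Factors (toForm (ψ ∘ ℓ 0F)) (toForm (ψ ∘ ℓ 1F)) (toForm (ψ ∘ ℓ 2F)) (toForm (ψ ∘ ℓ 3F))
    factors {ψ} ψ-hom ψ-φ p = begin
      G p                                                      ≈⟨ eval-Gpoly p ⟨
      eval (mapExpr φ Gq) (coordinates p)
        ≈⟨ Coefficients.eval-dehomogenize K (mapExpr φ Gq) (product (λ j → ψ ∘ ℓ j))
             (λ α d<α → trans (sym (φ.coeff-hom Gq α)) (trans (φ.⟦⟧-cong (proj₁ G-degree α d<α)) φ.0#-homo))
             coefficients (coordinates p) ⟩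
      eval (product (λ j → ψ ∘ ℓ j)) (Coefficients.cons1 K (coordinates p))
        ≈⟨ *-cong (*-cong (*-cong (lin 0F) (lin 1F)) (lin 2F)) (lin 3F) ⟩
      _ ∎
      where
      module ψ = Homomorphism K K ψ-hom
      lin = λ j → eval-linForm (ψ ∘ ℓ j) p
      L = λ j → linForm (ℓ j)
      L′ = λ j → linForm (ψ ∘ ℓ j)
      coefficients : ∀ β → homCoeff (mapExpr φ Gq) d β ≈ coeff (product (λ j → ψ ∘ ℓ j)) β
      coefficients β = begin
        homCoeff (mapExpr φ Gq) d β         ≈⟨ φ.homCoeff-hom Gq d β ⟨
        φ (PF.homCoeff Gq d β)              ≈⟨ ψ-φ _ ⟨
        ψ (φ (PF.homCoeff Gq d β))          ≈⟨ ψ.⟦⟧-cong (splitting β) ⟩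
        ψ (coeff (product ℓ) β)
          ≈⟨ ψ.coeff-⊗-hom (L 0F ⊗ L 1F ⊗ L 2F) (L 3F) (L′ 0F ⊗ L′ 1F ⊗ L′ 2F) (L′ 3F)
               (ψ.coeff-⊗-hom (L 0F ⊗ L 1F) (L 2F) (L′ 0F ⊗ L′ 1F) (L′ 2F)
                 (ψ.coeff-⊗-hom (L 0F) (L 1F) (L′ 0F) (L′ 1F) (ψ.coeff-linForm-hom (ℓ 0F)) (ψ.coeff-linForm-hom (ℓ 1F)))
                 (ψ.coeff-linForm-hom (ℓ 2F)))
               (ψ.coeff-linForm-hom (ℓ 3F)) β ⟩
        coeff (product (λ j → ψ ∘ ℓ j)) β   ∎

    private
      ℓ-factors : Factors (toForm (ℓ 0F)) (toForm (ℓ 1F)) (toForm (ℓ 2F)) (toForm (ℓ 3F))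
      ℓ-factors = factors (Identity.isRingHomomorphism rawRing refl) (λ _ → refl)

    -- A factor without linear part is a multiple of `X₀`, and then so is the product. But `d` is
    -- the exact degree, so some term of degree `d` enters the homogenization with exponent 0 at
    -- `X₀`.
    nonconstant : ∀ j → Nonconstant (toForm (ℓ j))
    nonconstant j (left≈0 , right≈0) with proj₂ G-degree
    ... | α , deg≡d , coeff≉0 = φ.injective₀ (begin
        φ (PF.coeff Gq α)                    ≡⟨ ≡.cong φ (top-coefficient deg≡d) ⟨
        φ (PF.homCoeff Gq d (0 ∷ α))         ≈⟨ splitting (0 ∷ α) ⟩
        coeff (product ℓ) (0 ∷ α)            ≈⟨ free j (free-linForm (ℓ j) coefficients≈0) α ⟩
        0#                                   ∎) coeff≉0
      where
      open Coefficients K using (NoTermFreeOfX₀; free-⊗ˡ; free-⊗ʳ; free-linForm)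

      ≡ᵇ-refl : ∀ n → (n ℕ.≡ᵇ n) ≡ true
      ≡ᵇ-refl zero = ≡.refl
      ≡ᵇ-refl (suc n) = ≡ᵇ-refl n

      top-coefficient : ∀ {d} → deg α ≡ d → PF.homCoeff Gq d (0 ∷ α) ≡ PF.coeff Gq α
      top-coefficient ≡.refl rewrite ≡ᵇ-refl (deg α) = ≡.refl

      coefficients≈0 : ∀ i → ℓ j (suc i) ≈ 0#
      coefficients≈0 0F = left≈0 0F
      coefficients≈0 1F = left≈0 1F
      coefficients≈0 2F = left≈0 2F
      coefficients≈0 3F = right≈0 0F
      coefficients≈0 4F = right≈0 1F
      coefficients≈0 5F = right≈0 2F

      L = λ j → linForm (ℓ j)
      free : ∀ j → NoTermFreeOfX₀ (L j) → NoTermFreeOfX₀ (product ℓ)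
      free 0F h = free-⊗ˡ (L 0F ⊗ L 1F ⊗ L 2F) (L 3F) (free-⊗ˡ (L 0F ⊗ L 1F) (L 2F) (free-⊗ˡ (L 0F) (L 1F) h))
      free 1F h = free-⊗ˡ (L 0F ⊗ L 1F ⊗ L 2F) (L 3F) (free-⊗ˡ (L 0F ⊗ L 1F) (L 2F) (free-⊗ʳ (L 0F) (L 1F) h))
      free 2F h = free-⊗ˡ (L 0F ⊗ L 1F ⊗ L 2F) (L 3F) (free-⊗ʳ (L 0F ⊗ L 1F) (L 2F) h)
      free 3F h = free-⊗ʳ (L 0F ⊗ L 1F ⊗ L 2F) (L 3F) h

    product-zero : (v : Fin 4 → Carrier) → ∀ j → v j ≈ 0# → v 0F * v 1F * v 2F * v 3F ≈ 0#
    product-zero v 0F v≈0 = trans (*-congʳ (*-congʳ (*-congʳ v≈0))) (solve 3 (λ a b c → O :* a :* b :* c := O) refl (v 1F) (v 2F) (v 3F))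
    product-zero v 1F v≈0 = trans (*-congʳ (*-congʳ (*-congˡ v≈0))) (solve 3 (λ a b c → a :* O :* b :* c := O) refl (v 0F) (v 2F) (v 3F))
    product-zero v 2F v≈0 = trans (*-congʳ (*-congˡ v≈0)) (solve 3 (λ a b c → a :* b :* O :* c := O) refl (v 0F) (v 1F) (v 3F))
    product-zero v 3F v≈0 = trans (*-congˡ v≈0) (zeroʳ _)

    diagonal-factor : ¬ ¬ (∃ λ j → Vanishes Diagonal (toForm (ℓ j)))
    diagonal-factor none = Subspace.some-factor-vanishes Diagonal (λ t {p} {r} → Diagonal-line t {p} {r}) {0ᵛ , 0ᵛ} (λ _ → refl)
      (λ j → value (toForm (ℓ j))) (λ j → value-affine (toForm (ℓ j)))
      (λ p p∈ → trans (sym (ℓ-factors p)) (G-diagonal p p∈)) none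

    module _ (ovoid : Geometry.IsOvoid Fq (Construction.O₇ Fq f₁ f₂ f₃))
      (j : Fin 4) (ℓⱼ-diagonal : Vanishes Diagonal (toForm (ℓ j))) where

      private
        c : V
        c = left (toForm (ℓ j))

        zero-value : ∀ a → c ∙ a ≈ 0# → G (a , 0ᵛ) ≈ 0#
        zero-value a ca≈0 = trans (ℓ-factors (a , 0ᵛ)) (product-zero (λ j → value (toForm (ℓ j)) (a , 0ᵛ)) j (begin
          const (toForm (ℓ j)) + (c ∙ a + right (toForm (ℓ j)) ∙ 0ᵛ)
            ≈⟨ +-cong (diagonal-const {toForm (ℓ j)} ℓⱼ-diagonal) (+-cong ca≈0 (∙-0 (right (toForm (ℓ j))))) ⟩
          0# + (0# + 0#)  ≈⟨ solve 0 (O :+ (O :+ O) := O) refl ⟩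
          0#              ∎))

      -- If c·u = 0, factor `j` vanishes at (u, 0), hence so does G. Because the `fᵢ` vanish at 0,
      -- that value is minus the image of `s`, and the resulting `s = 0` contradicts the ovoid
      -- property.
      independent : ∀ x y z i → ¬ lookup (x ∷ y ∷ z ∷ []) i Fq.≈ Fq.0# → ¬ c ∙ (φ ∘ lookup (x ∷ y ∷ z ∷ [])) ≈ 0#
      independent x y z i u≉0 cu≈0 = φ.injective₀ {s} s≈0 λ s≈0 →
        Generator.perpendicular⇒¬ovoid Fq f₁ f₂ f₃ f₁0 f₂0 f₃0 x y z i u≉0 s≈0 ovoid
        where
        u = lookup (x ∷ y ∷ z ∷ [])
        s = x Fq.* PF.eval f₃ u Fq.+ y Fq.* PF.eval f₂ u Fq.+ z Fq.* PF.eval f₁ u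

        f-zero : ∀ f → PF.eval f (λ _ → Fq.0#) Fq.≈ Fq.0# → eval (mapExpr φ f) 0ᵛ ≈ 0#
        f-zero f f0 = begin
          eval (mapExpr φ f) 0ᵛ                 ≈⟨ Evaluation.eval-cong K (mapExpr φ f) (λ _ → sym φ.0#-homo) ⟩
          eval (mapExpr φ f) (λ _ → φ Fq.0#)    ≈⟨ φ.eval-hom f (λ _ → Fq.0#) ⟨
          φ (PF.eval f (λ _ → Fq.0#))           ≈⟨ trans (φ.⟦⟧-cong f0) φ.0#-homo ⟩
          0#                                    ∎

        term : ∀ i f → PF.eval f (λ _ → Fq.0#) Fq.≈ Fq.0# →
          φ (u i Fq.* PF.eval f u) ≈ - ((φ (u i) - 0#) * (eval (mapExpr φ f) 0ᵛ - eval (mapExpr φ f) (φ ∘ u)))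
        term i f f0 = begin
          φ (u i Fq.* PF.eval f u)                           ≈⟨ trans (φ.*-homo _ _) (*-congˡ (φ.eval-hom f u)) ⟩
          φ (u i) * eval (mapExpr φ f) (φ ∘ u)
            ≈⟨ solve 2 (λ a b → a :* b := :- ((a :- O) :* (O :- b))) refl _ _ ⟩
          - ((φ (u i) - 0#) * (0# - eval (mapExpr φ f) (φ ∘ u))) ≈⟨ -‿cong (*-congˡ (+-congʳ (f-zero f f0))) ⟨
          - ((φ (u i) - 0#) * (eval (mapExpr φ f) 0ᵛ - eval (mapExpr φ f) (φ ∘ u))) ∎

        s≈0 : φ s ≈ 0#
        s≈0 = begin
          φ s
            ≈⟨ trans (φ.+-homo _ _) (+-cong (trans (φ.+-homo _ _) (+-cong (term 0F f₃ f₃0) (term 1F f₂ f₂0))) (term 2F f₁ f₁0)) ⟩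
          - _ + - _ + - _          ≈⟨ solve 3 (λ a b c → :- a :+ :- b :+ :- c := :- (a :+ b :+ c)) refl _ _ _ ⟩
          - G (φ ∘ u , 0ᵛ)         ≈⟨ -‿cong (zero-value (φ ∘ u) cu≈0) ⟩
          - 0#                     ≈⟨ solve 0 (:- O := O) refl ⟩
          0#                       ∎

      contradictory : ⊥
      contradictory = Basis.no-factorization conj (dual conj) det≉0 (dual-off conj) (dual-expansion conj)
          {toForm (ℓ 0F)} {toForm (ℓ 1F)} {toForm (ℓ 2F)} {toForm (ℓ 3F)} (λ i p p∈ → trans (factors (ψ-hom i) (ψ-φ i) p)
          (product-zero (λ j → value (toForm (ψ i ∘ ℓ j)) p) j (conjugate-vanishes i p p∈)))
          (nonconstant 0F) (nonconstant 1F) (nonconstant 2F) (nonconstant 3F) ℓ-factors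
        where
        c₀≉0 : ¬ c 0F ≈ 0#
        c₀≉0 c₀≈0 = independent Fq.1# Fq.0# Fq.0# 0F Fq.1≉0 (trans
          (+-cong (+-cong (*-congʳ c₀≈0) (*-congˡ φ.0#-homo)) (*-congˡ φ.0#-homo))
          (solve 3 (λ a b c → O :* a :+ b :* O :+ c :* O := O) refl _ _ _))

        c₀⁻¹ = proj₁ (inverse (c 0F) c₀≉0)

        -- Scaling the first coordinate to 1 puts c into the form that `moore` expects and leaves
        -- its hyperplane unchanged.
        n : V
        n i = c i * c₀⁻¹

        n₀≈1 : n 0F ≈ 1#
        n₀≈1 = proj₂ (inverse (c 0F) c₀≉0)

        c≈c₀n : ∀ i → c i ≈ c 0F * n i
        c≈c₀n i = begin
          c i                    ≈⟨ *-identityˡ _ ⟨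
          1# * c i               ≈⟨ *-congʳ n₀≈1 ⟨
          c 0F * c₀⁻¹ * c i      ≈⟨ solve 3 (λ a b c → a :* b :* c := a :* (c :* b)) refl _ _ _ ⟩
          c 0F * n i             ∎

        n-independent : ∀ x y z i → ¬ lookup (x ∷ y ∷ z ∷ []) i Fq.≈ Fq.0# → ¬ n ∙ (φ ∘ lookup (x ∷ y ∷ z ∷ [])) ≈ 0#
        n-independent x y z i u≉0 nu≈0 = independent x y z i u≉0 (begin
          c ∙ (φ ∘ lookup (x ∷ y ∷ z ∷ []))
            ≈⟨ +-cong (+-cong (*-congʳ (c≈c₀n 0F)) (*-congʳ (c≈c₀n 1F))) (*-congʳ (c≈c₀n 2F)) ⟩
          c 0F * n 0F * φ x + c 0F * n 1F * φ y + c 0F * n 2F * φ z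
            ≈⟨ solve 7 (λ k a b c x y z → k :* a :* x :+ k :* b :* y :+ k :* c :* z := k :* (a :* x :+ b :* y :+ c :* z))
                 refl (c 0F) (n 0F) (n 1F) (n 2F) (φ x) (φ y) (φ z) ⟩
          c 0F * n ∙ (φ ∘ lookup (x ∷ y ∷ z ∷ []))     ≈⟨ trans (*-congˡ nu≈0) (zeroʳ _) ⟩
          0# ∎)

        conj : Fin 3 → V
        conj = conjugates σ-hom (λ z → ∃ λ a → φ a ≈ z) σ-fixed n

        det≉0 : ¬ det conj ≈ 0#
        det≉0 = moore σ-hom (λ z → ∃ λ a → φ a ≈ z) σ-fixed n n₀≈1
          -- A relation n₁ = a would make (-a, 1, 0) a solution of n·u = 0 over 𝔽_q, and n₂ = z·n₁ +
          -- b would make (-b, -z, 1) one; both are nonzero.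
          (λ α (a , φa≈α) n₁≈α → n-independent (Fq.- a) Fq.1# Fq.0# 1F Fq.1≉0 (begin
            n 0F * φ (Fq.- a) + n 1F * φ Fq.1# + n 2F * φ Fq.0#
              ≈⟨ +-cong (+-cong (*-cong n₀≈1 (trans (φ.-‿homo a) (-‿cong φa≈α))) (*-cong n₁≈α φ.1#-homo)) (*-congˡ φ.0#-homo) ⟩
            1# * - α + α * 1# + n 2F * 0#
              ≈⟨ solve 2 (λ α m → I :* (:- α) :+ α :* I :+ m :* O := O) refl α (n 2F) ⟩
            0# ∎))
          (λ ζ β (z , φz≈ζ) (b , φb≈β) n₂≈ → n-independent (Fq.- b) (Fq.- z) Fq.1# 2F Fq.1≉0 (begin
            n 0F * φ (Fq.- b) + n 1F * φ (Fq.- z) + n 2F * φ Fq.1#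
              ≈⟨ +-cong (+-cong (*-cong n₀≈1 (trans (φ.-‿homo b) (-‿cong φb≈β))) (*-congˡ (trans (φ.-‿homo z) (-‿cong φz≈ζ)))) (*-cong n₂≈ φ.1#-homo) ⟩
            1# * - β + n 1F * - ζ + (ζ * n 1F + β) * 1#
              ≈⟨ solve 3 (λ β ζ m → I :* (:- β) :+ m :* (:- ζ) :+ (ζ :* m :+ β) :* I := O) refl β ζ (n 1F) ⟩
            0# ∎))

        ψ : Fin 3 → Carrier → Carrier
        ψ 0F = id
        ψ 1F = σ
        ψ 2F = σ ∘ σ

        ψ-hom : ∀ i → IsFieldHom K K (ψ i)
        ψ-hom 0F = Identity.isRingHomomorphism rawRing refl
        ψ-hom 1F = σ-hom
        ψ-hom 2F = Composition.isRingHomomorphism trans σ-hom σ-hom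

        ψ-φ : ∀ i x → ψ i (φ x) ≈ φ x
        ψ-φ 0F x = refl
        ψ-φ 1F x = σ-φ x
        ψ-φ 2F x = trans (^-congˡ q (σ-φ x)) (σ-φ x)

        conj≡ψn : ∀ i k → conj i k ≡ ψ i (n k)
        conj≡ψn 0F k = ≡.refl
        conj≡ψn 1F k = ≡.refl
        conj≡ψn 2F k = ≡.refl

        -- Factor `j` is c·(a - b) with c = c₀·n, so its conjugate is ψ(c₀) times `conj i`·(a - b).
        conjugate-vanishes : ∀ i → Vanishes (Hyperplane (conj i)) (toForm (ψ i ∘ ℓ j))
        conjugate-vanishes i (a , b) p∈ = begin
          ψ i (const A) + (lᵢ ∙ a + rᵢ ∙ b)
            ≈⟨ +-cong (trans (ψᵢ.⟦⟧-cong (diagonal-const {A} ℓⱼ-diagonal)) ψᵢ.0#-homo)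
                 (+-cong (∙-scaled l≈ a) (∙-scaled r≈ b)) ⟩
          0# + (e₀ * conj i ∙ a + - e₀ * conj i ∙ b)
            ≈⟨ +-congˡ (+-congʳ (*-congˡ p∈)) ⟩
          0# + (e₀ * conj i ∙ b + - e₀ * conj i ∙ b)
            ≈⟨ solve 2 (λ k x → O :+ (k :* x :+ (:- k) :* x) := O) refl e₀ (conj i ∙ b) ⟩
          0# ∎
          where
          module ψᵢ = Homomorphism K K (ψ-hom i)
          A = toForm (ℓ j)
          lᵢ = left (toForm (ψ i ∘ ℓ j))
          rᵢ = right (toForm (ψ i ∘ ℓ j))
          e₀ = ψ i (c 0F)

          ∙-scaled : ∀ {s u} → (∀ k → u k ≈ s * conj i k) → ∀ a → u ∙ a ≈ s * conj i ∙ a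
          ∙-scaled {s} u≈ a = trans
            (+-cong (+-cong (*-congʳ (u≈ 0F)) (*-congʳ (u≈ 1F))) (*-congʳ (u≈ 2F)))
            (solve 7 (λ k a b c x y z → k :* a :* x :+ k :* b :* y :+ k :* c :* z := k :* (a :* x :+ b :* y :+ c :* z))
              refl s (conj i 0F) (conj i 1F) (conj i 2F) (a 0F) (a 1F) (a 2F))

          l≈ : ∀ k → lᵢ k ≈ e₀ * conj i k
          l≈ k = trans (ψᵢ.⟦⟧-cong (c≈c₀n k)) (trans (ψᵢ.*-homo _ _) (*-congˡ (reflexive (≡.sym (conj≡ψn i k)))))

          r≈ : ∀ k → rᵢ k ≈ - e₀ * conj i k
          r≈ k = begin
            ψ i (right A k)      ≈⟨ ψᵢ.⟦⟧-cong (trans (sym (∙-e (right A) k))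
                                      (trans (diagonal-right {A} ℓⱼ-diagonal (e k)) (-‿cong (∙-e c k)))) ⟩
            ψ i (- c k)          ≈⟨ ψᵢ.-‿homo (c k) ⟩
            - ψ i (c k)          ≈⟨ -‿cong (l≈ k) ⟩
            - (e₀ * conj i k)       ≈⟨ solve 2 (λ a b → :- (a :* b) := :- a :* b) refl e₀ (conj i k) ⟩
            - e₀ * conj i k         ∎

  not-ovoid : ∀ {d} → PF.HasDegree Gq d → (ℓ : Fin 4 → Fin 7 → Carrier) →
    (∀ β → φ (PF.homCoeff Gq d β) ≈ coeff (product ℓ) β) → ¬ Geometry.IsOvoid Fq (Construction.O₇ Fq f₁ f₂ f₃)
  not-ovoid G-degree ℓ splitting ovoid = diagonal-factor G-degree ℓ splitting λ (j , vanishes) →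
    contradictory G-degree ℓ splitting ovoid j vanishes

-- Passage to stable equality and the bound on q

open import Data.Nat using (_*_; _^_)

-- The bound q > 6.3 · 4^(13/3) is cubed and cleared of denominators: 6.3³ = 250.047 and 4^13 =
-- 2^26.
theorem5p1 : (q : ℕ) → IsPrimePower q → 250047 * 2 ^ 26 < 1000 * q ^ 3 →
    (Fq : Field) → HasSize Fq q →
    (f₁ f₂ f₃ : Expr (Field.Carrier Fq) 3) →
    Poly.HasDegree Fq f₁ 3 → Poly.HasDegree Fq f₂ 3 → Poly.HasDegree Fq f₃ 3 →
    Field._≈_ Fq (Poly.eval Fq f₁ (λ _ → Field.0# Fq)) (Field.0# Fq) →
    Field._≈_ Fq (Poly.eval Fq f₂ (λ _ → Field.0# Fq)) (Field.0# Fq) →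
    Field._≈_ Fq (Poly.eval Fq f₃ (λ _ → Field.0# Fq)) (Field.0# Fq) →
    SplitsIntoFourHyperplanes Fq (Construction.Gpoly Fq f₁ f₂ f₃) →
    ¬ Geometry.IsOvoid Fq (Construction.O₇ Fq f₁ f₂ f₃)
theorem5p1 q (p , k , p-prime , _ , q≡p^k) large Fq size f₁ f₂ f₃ _ _ _ f₁0 f₂0 f₃0
  (d , G-degree , K , φ , φ-hom , ℓ , _ , splitting) =
  Core.not-ovoid {k = k} p-prime q≡p^k (5≤ large) Fq size f₁ f₂ f₃ f₁0 f₂0 f₃0
    -- Stability of the new equality is the collapse of four negations to two.
    (Stabilise.stabilise K) (λ ¬¬¬¬x≈y x≉y → ¬¬¬¬x≈y λ ¬¬x≈y → ¬¬x≈y x≉y)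
    (Stabilise.stabilise-hom K {Fq} φ-hom) G-degree ℓ (λ β ≉ → ≉ (splitting β))
  where
  5≤ : ∀ {q} → 250047 * 2 ^ 26 < 1000 * q ^ 3 → 5 ≤ q
  5≤ {q} large with 5 ℕ.≤? q
  ... | yes 5≤q = 5≤q
  -- For q ≤ 4 the right-hand side is at most 1000 · 4³, far below the left-hand side.
  ... | no 5≰q = contradiction large (ℕ.≤⇒≯ (ℕ.≤-trans
    (ℕ.*-monoʳ-≤ 1000 (ℕ.^-monoˡ-≤ 3 (ℕ.s≤s⁻¹ (ℕ.≰⇒> 5≰q)))) (ℕ.≤ᵇ⇒≤ (1000 * 4 ^ 3) (250047 * 2 ^ 26) tt)))
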